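{- Fix a total order on the set $\mathbb M$ of marks. For every marked forest $(T,\mathsf m)$, $$D_{(T,\mathsf m)}(\mathbf z)=M'_{(T,\mathsf m)}(z_{w,d}=D_{\bullet_{w,d}}).$$
   Context: A mark is a pair $(w,d)$ of integers with $w\ge1,d\ge0,w\ge d+1$; $\mathbb M$ is the set of marks, with dot-sum $(w,d)\dotplus(w',d')=(w+w',d+d'+1)$. A marked forest $(T,\mathsf m)$ is a forest with a mark on each vertex. Contracting an edge $e=uv$ merges $u,v$ into one vertex (inheriting the other incident edges) with mark $\mathsf m(u)\dotplus\mathsf m(v)$; for disjoint edge sets $A_1,A_2$, $(T/A_1\setminus A_2,\mathsf m/A_1)$ contracts the edges of $A_1$ and deletes those of $A_2$. The $M$-polynomial $M_{(T,\mathsf m)}(\mathbf z)=\sum_{A\subseteq E(T)}\prod_C z_{\mathsf m(C)}$ (product over connected components $C$ of $(V(T),A)$, $\mathsf m(C)$ the dot-sum of marks of the vertices of $C$), in commuting indeterminates $z_{w,d}$. With $D_{\bullet_{w,d}}=\sum_{i=0}^d(-1)^i\binom di z_{w-i,0}z_{1,0}^i$, $D_{(T,\mathsf m)}(\mathbf z)$ is $M_{(T,\mathsf m)}$ with each $z_{w,d}$ replaced by $D_{\bullet_{w,d}}$. A vertex is absorbable if it has degree $1$ and mark $(1,0)$; absorbing an edge $uv$ with $v$ absorbable and $\mathsf m(u)=(w,d)$ contracts it and gives the merged vertex mark $(w+1,d)$; the core of $(T,\mathsf m)$ is obtained by absorbing edges incident with absorbable vertices until none remain. The polynomial $M'_{(T,\mathsf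 m)}(\mathbf z)$ is defined recursively: (1) if $T$ is a single vertex with mark $(w,d)$, $M'=z_{w,d}$; (2) if $T$ has connected components $(T_1,\mathsf m_1),\dots,(T_k,\mathsf m_k)$ with $k>1$, $M'_{(T,\mathsf m)}=\prod_i M'_{(T_i,\mathsf m_i)}$; (3) if $T$ is connected and has absorbable vertices, $M'_{(T,\mathsf m)}=M'$ of its core; (4) if $T$ is connected, has at least one edge and no absorbable vertices, let $A$ be the set of pendant edges (edges incident with a leaf); if $T$ is a star whose center has mark $(1,0)$, let $e$ be the pendant edge incident with the leaf of largest mark in the fixed order (ties broken arbitrarily) and $A'=A\setminus\{e\}$; otherwise $A'=A$; then $M'_{(T,\mathsf m)}=\sum_{A_1\sqcup A_2=A'}M'_{(T/A_1\setminus A_2,\mathsf m/A_1)}$, the sum over ordered pairs of disjoint sets with union $A'$. -}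

module Defs where

open import Level using (Level; 0ℓ)
open import Data.Bool using (Bool; true; false; _∧_; _∨_; not; if_then_else_)
open import Data.Nat using (ℕ; zero; suc; _+_; _∸_; _<_; _≤_; _≡ᵇ_)
open import Data.Nat.Properties using (+-mono-≤; +-suc; ≤-trans; ≤-reflexive; m≤n⇒m≤1+n)
open import Data.Bool.ListAction using (any)
open import Data.Nat.Combinatorics using (_C_)
open import Data.List using (List; []; _∷_; _++_; map; filterᵇ; length; foldr; upTo; _∷ʳ_)
open import Data.List.Membership.Propositional using (_∈_)
open import Data.List.Relation.Unary.All using (All)
open import Data.List.Relation.Unary.AllPairs using (AllPairs)
open import Data.List.Relation.Unary.Unique.Propositional using (Unique)
open import Data.List.Relation.Unary.Linked using (Linked)
open import Data.List.Relation.Binary.Pointwise using (Pointwise)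
open import Data.Maybe using (Maybe; just; nothing)
open import Data.Product using (Σ; ∃; _×_; _,_; proj₁; proj₂)
open import Data.Sum using (_⊎_)
open import Relation.Binary.PropositionalEquality using (_≡_; _≢_; cong; sym)
open import Relation.Nullary using (¬_)
open import Relation.Binary using (Rel)
open import Algebra.Bundles using (CommutativeRing; Semiring)
import Algebra.Definitions.RawSemiring as RS

record Mark : Set where
  constructor mark
  field
    w     : ℕ
    d     : ℕ
    valid : suc d ≤ w
open Mark public

_∔_ : Mark → Mark → Mark
mark w d p ∔ mark w' d' p' =
  mark (w + w') (suc (d + d'))
       (≤-trans (≤-reflexive (cong suc (sym (+-suc d d')))) (+-mono-≤ p p'))

absorbMark : Mark → Mark
absorbMark (mark w d p) = mark (suc w) d (m≤n⇒m≤1+n p)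

-- Marked graphs: vertices are (identifier , mark) entries, edges are
-- pairs of identifiers.

Entry : Set
Entry = ℕ × Mark

Edge : Set
Edge = ℕ × ℕ

record MGraph : Set where
  constructor graph
  field
    verts : List Entry
    edges : List Edge
open MGraph public

ids : MGraph → List ℕ
ids G = map proj₁ (verts G)

elem : ℕ → List ℕ → Bool
elem x xs = any (λ y → x ≡ᵇ y) xs

eqE : Edge → Edge → Bool
eqE (a , b) (c , e) = (a ≡ᵇ c) ∧ (b ≡ᵇ e)

adjᵇ : List Edge → ℕ → ℕ → Bool
adjᵇ E x y = any (λ ab → ((proj₁ ab ≡ᵇ x) ∧ (proj₂ ab ≡ᵇ y)) ∨ ((proj₁ ab ≡ᵇ y) ∧ (proj₂ ab ≡ᵇ x))) E

applyN : {A : Set} → ℕ → (A → A) → A → A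
applyN zero    f x = x
applyN (suc n) f x = f (applyN n f x)

Adj : MGraph → ℕ → ℕ → Set
Adj G u v = ((u , v) ∈ edges G) ⊎ ((v , u) ∈ edges G)

SameEdge : Edge → Edge → Set
SameEdge (a , b) (c , e) = (a ≡ c × b ≡ e) ⊎ (a ≡ e × b ≡ c)

Cycle : MGraph → List ℕ → Set
Cycle G []       = Data.Empty.⊥ where import Data.Empty
Cycle G (x ∷ xs) = (2 ≤ length xs) × Unique (x ∷ xs) × Linked (Adj G) ((x ∷ xs) ∷ʳ x)

IsMarkedForest : MGraph → Set
IsMarkedForest G =
  (verts G ≢ []) ×
  Unique (ids G) ×
  All (λ e → proj₁ e ∈ ids G × proj₂ e ∈ ids G × proj₁ e ≢ proj₂ e) (edges G) ×
  AllPairs (λ e e′ → ¬ SameEdge e e′) (edges G) ×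
  (∀ xs → ¬ Cycle G xs)

grow : List ℕ → List Edge → List ℕ → List ℕ
grow vs E S = filterᵇ (λ y → elem y S ∨ any (λ x → adjᵇ E x y) S) vs

reach : MGraph → ℕ → List ℕ
reach G v = applyN (length (ids G)) (grow (ids G) (edges G)) (v ∷ [])

repsFrom : MGraph → List ℕ → List Entry → List Entry
repsFrom G prev []       = []
repsFrom G prev (v ∷ vs) =
  if any (λ p → elem p (reach G (proj₁ v))) prev
  then repsFrom G (prev ∷ʳ proj₁ v) vs
  else v ∷ repsFrom G (prev ∷ʳ proj₁ v) vs

reps : MGraph → List Entry
reps G = repsFrom G [] (verts G)

componentOf : MGraph → Entry → MGraph
componentOf G v =
  graph (filterᵇ (λ e → elem (proj₁ e) (reach G (proj₁ v))) (verts G))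
        (filterᵇ (λ e → elem (proj₁ e) (reach G (proj₁ v))) (edges G))

components : MGraph → List MGraph
components G = map (componentOf G) (reps G)

Connected : MGraph → Set
Connected G = length (components G) ≡ 1

compMark : MGraph → Entry → Mark
compMark G v =
  foldr (λ e m → proj₂ e ∔ m) (proj₂ v)
        (filterᵇ (λ e → elem (proj₁ e) (reach G (proj₁ v)) ∧ not (proj₁ e ≡ᵇ proj₁ v)) (verts G))

subsets : {A : Set} → List A → List (List A)
subsets []       = [] ∷ []
subsets (x ∷ xs) = map (x ∷_) (subsets xs) ++ subsets xs

splits : {A : Set} → List A → List (List A × List A)
splits []       = ([] , []) ∷ []
splits (x ∷ xs) =
  map (λ p → (x ∷ proj₁ p , proj₂ p)) (splits xs) ++
  map (λ p → (proj₁ p , x ∷ proj₂ p)) (splits xs)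

deg : MGraph → ℕ → ℕ
deg G x = length (filterᵇ (λ e → (proj₁ e ≡ᵇ x) ∨ (proj₂ e ≡ᵇ x)) (edges G))

pendant : MGraph → List Edge
pendant G = filterᵇ (λ e → (deg G (proj₁ e) ≡ᵇ 1) ∨ (deg G (proj₂ e) ≡ᵇ 1)) (edges G)

markOf : List Entry → ℕ → Maybe Mark
markOf []             x = nothing
markOf ((j , m) ∷ vs) x = if j ≡ᵇ x then just m else markOf vs x

renameV : ℕ → ℕ → ℕ → ℕ
renameV u v x = if x ≡ᵇ v then u else x

renameE : ℕ → ℕ → Edge → Edge
renameE u v (a , b) = (renameV u v a , renameV u v b)

mergeWith : (Mark → Mark → Mark) → ℕ → ℕ → MGraph → MGraph
mergeWith f u v G with markOf (verts G) v
... | nothing = G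
... | just mv =
  graph (map upd (filterᵇ (λ e → not (proj₁ e ≡ᵇ v)) (verts G)))
        (map (renameE u v)
             (filterᵇ (λ e → not (eqE e (u , v) ∨ eqE e (v , u))) (edges G)))
  where
  upd : Entry → Entry
  upd (j , m) = if j ≡ᵇ u then (j , f m mv) else (j , m)

contract1 : Edge → MGraph → MGraph
contract1 (u , v) G = mergeWith _∔_ u v G

-- contract the edges of a list one after another; ρ records how the
-- identifiers of the original graph have been renamed by earlier contractions
contractAcc : (ℕ → ℕ) → List Edge → MGraph → MGraph
contractAcc ρ []             G = G
contractAcc ρ ((u , v) ∷ es) G =
  contractAcc (λ x → renameV (ρ u) (ρ v) (ρ x)) es (contract1 (ρ u , ρ v) G)

contractAll : List Edge → MGraph → MGraph
contractAll A G = contractAcc (λ x → x) A G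

deleteAll : List Edge → MGraph → MGraph
deleteAll A G = graph (verts G) (filterᵇ (λ e → not (any (eqE e) A)) (edges G))

contractDelete : List Edge × List Edge → MGraph → MGraph
contractDelete (A₁ , A₂) G = contractAll A₁ (deleteAll A₂ G)

Is10 : Mark → Set
Is10 m = w m ≡ 1 × d m ≡ 0

Absorbable : MGraph → Entry → Set
Absorbable G (v , m) = deg G v ≡ 1 × Is10 m

HasAbsorbable : MGraph → Set
HasAbsorbable G = ∃ λ e → e ∈ verts G × Absorbable G e

absorb : ℕ → ℕ → MGraph → MGraph
absorb u v G = mergeWith (λ mu _ → absorbMark mu) u v G

data Core : MGraph → MGraph → Set where
  done : ∀ {G} → ¬ HasAbsorbable G → Core G G
  step : ∀ {G G′} u v mv → (v , mv) ∈ verts G → Absorbable G (v , mv) → Adj G u v →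
         Core (absorb u v G) G′ → Core G G′

-- every edge is incident with the vertex c  (for connected G: G is a star with centre c)
StarAt : MGraph → ℕ → Set
StarAt G c = All (λ e → proj₁ e ≡ c ⊎ proj₂ e ≡ c) (edges G)

StarCentre10 : MGraph → Set
StarCentre10 G = ∃ λ c → ∃ λ m → (c , m) ∈ verts G × StarAt G c × Is10 m

module WithRing {c ℓ : Level} (R : CommutativeRing c ℓ) where
  open CommutativeRing R renaming (_+_ to _+ᵣ_; _*_ to _*ᵣ_)
  open RS (Semiring.rawSemiring semiring) using () renaming (_×_ to _·_; _^_ to _^ᵣ_)

  sumR : List Carrier → Carrier
  sumR = foldr _+ᵣ_ 0#

  prodR : List Carrier → Carrier
  prodR = foldr _*ᵣ_ 1#

  Dbullet : (ℕ → ℕ → Carrier) → Mark → Carrier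
  Dbullet z m =
    sumR (map (λ i → ((- 1#) ^ᵣ i) *ᵣ (((d m) C i) · 1#) *ᵣ z (w m ∸ i) 0 *ᵣ (z 1 0 ^ᵣ i))
              (upTo (suc (d m))))

  -- M-polynomial evaluated at z_{w,d} := val (w,d)
  Mpoly : (Mark → Carrier) → MGraph → Carrier
  Mpoly val G =
    sumR (map (λ A → prodR (map (λ v → val (compMark (graph (verts G) A) v))
                                (reps (graph (verts G) A))))
              (subsets (edges G)))

  Dpoly : (ℕ → ℕ → Carrier) → MGraph → Carrier
  Dpoly z G = Mpoly (Dbullet z) G

  -- IsM' G p : p is a value of M'_{G} at z_{w,d} := val (w,d), computed by
  -- the recursive definition (any admissible choices for ties / absorption order)
  module M′ (_≤M_ : Rel Mark 0ℓ) (val : Mark → Carrier) where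

    LargestLeafEdge : MGraph → Edge → Set
    LargestLeafEdge G e =
      ∃ λ ℓv → ∃ λ mℓ → (ℓv , mℓ) ∈ verts G × deg G ℓv ≡ 1 ×
        e ∈ edges G × (proj₁ e ≡ ℓv ⊎ proj₂ e ≡ ℓv) ×
        (∀ j mj → (j , mj) ∈ verts G → deg G j ≡ 1 → mj ≤M mℓ)

    data IsM′ : MGraph → Carrier → Set (c Level.⊔ ℓ) where
      single  : ∀ G i m → verts G ≡ (i , m) ∷ [] → edges G ≡ [] →
                IsM′ G (val m)
      comps   : ∀ G ps → 1 < length (components G) →
                Pointwise IsM′ (components G) ps → IsM′ G (prodR ps)
      core    : ∀ G G′ p → Connected G → HasAbsorbable G → Core G G′ →
                IsM′ G′ p → IsM′ G p
      pend    : ∀ G ps → Connected G → edges G ≢ [] → ¬ HasAbsorbable G →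
                ¬ StarCentre10 G →
                Pointwise IsM′ (map (λ s → contractDelete s G) (splits (pendant G))) ps →
                IsM′ G (sumR ps)
      pendStar : ∀ G e ps → Connected G → edges G ≢ [] → ¬ HasAbsorbable G →
                StarCentre10 G → LargestLeafEdge G e →
                Pointwise IsM′ (map (λ s → contractDelete s G)
                                    (splits (filterᵇ (λ f → not (eqE f e)) (pendant G)))) ps →
                IsM′ G (sumR ps)

{-# OPTIONS --safe #-}
-- The subset expansion satisfies deletion-contraction and is multiplicative
-- over connected components, for any values φ(w, d) of the indeterminates:
-- contracting uv identifies the blocks of A ∪ {uv} with those of A / uv.
-- Expanding along pendant edges therefore leaves it unchanged. Absorbing a
-- leaf of mark (1,0) is harmless as soon as
--   φ(w+1, d) = φ(w+1, d+1) + φ(1, 0) φ(w, d),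
-- which for D_• is Pascal's rule. So every run of the recursion returns D, and
-- runs exist because a forest with an edge has a leaf, so that each step
-- decreases the number of vertices plus edges.
module Submission where

open import Defs
open import Level using (Level; 0ℓ)
open import Algebra.Bundles using (CommutativeRing; Semiring)
import Algebra.Definitions.RawSemiring as RS
import Algebra.Properties.CommutativeSemigroup as CommutativeSemigroup
import Algebra.Properties.Monoid.Mult as Mult
import Algebra.Properties.Ring as RingProperties
open import Data.Bool using (Bool; true; false; T; _∧_; _∨_; not; if_then_else_)
open import Data.Bool.ListAction using (any; or)
open import Data.Bool.Properties using (T-∧; T-∨; T?; T-≡; ∧-comm)
open import Data.Empty using (⊥; ⊥-elim)
open import Data.List using (List; []; _∷_; _++_; map; filterᵇ; foldr; length; _∷ʳ_; upTo; applyUpTo)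
open import Data.List.Properties using (map-++; map-∘; map-id; map-cong; map-upTo; length-map; length-++; ++-assoc; applyUpTo-∷ʳ; filter-all; filter-none; filter-notAll; filter-accept; filter-reject; length-filter)
open import Data.List.Membership.Propositional using (_∈_; _∉_; find; lose)
open import Data.List.Membership.Propositional.Properties using (∈-map⁺; ∈-map⁻; ∈-filter⁺; ∈-filter⁻; ∈-∃++; ∈-++⁺ˡ; ∈-++⁺ʳ; ∈-++⁻; ∈-insert)
open import Data.List.Relation.Binary.Permutation.Propositional using (_↭_; prep; swap; ↭⇒↭ₛ; ↭-refl; ↭-sym)
open import Data.List.Relation.Binary.Permutation.Propositional.Properties using (shift; ∈-resp-↭)
import Data.List.Relation.Binary.Permutation.Setoid.Properties as ↭ₛ
open import Data.List.Relation.Binary.Pointwise using (Pointwise; []; _∷_)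
open import Data.List.Relation.Unary.All as All using (All; []; _∷_)
import Data.List.Relation.Unary.All.Properties as All
open import Data.List.Relation.Unary.AllPairs as AllPairs using (AllPairs; []; _∷_)
import Data.List.Relation.Unary.AllPairs.Properties as AllPairs
open import Data.List.Relation.Unary.Any using (Any; here; there; any?)
open import Data.List.Relation.Unary.Any.Properties using (any⁺; any⁻)
open import Data.List.Relation.Unary.Linked as Linked using (Linked; [-]; _∷_)
import Data.List.Relation.Unary.Linked.Properties as Linked
open import Data.List.Relation.Unary.Unique.Propositional using (Unique)
import Data.List.Relation.Unary.Unique.Propositional.Properties as Unique
open import Data.Maybe using (just)
open import Data.Nat using (ℕ; zero; suc; pred; _+_; _∸_; _<_; _≤_; _≡ᵇ_; _≟_; z≤n; s≤s)
open import Data.Nat.Combinatorics using (_C_; nCk+nC[k+1]≡[n+1]C[k+1]; k>n⇒nCk≡0)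
open import Data.Nat.Properties as ℕ using (≡ᵇ⇒≡; ≡⇒≡ᵇ; ≤-refl; ≤-trans; ≤-reflexive; <⇒≤; <-irrefl; m≤n⇒m≤1+n; +-mono-≤-<)
open import Data.List.Membership.DecPropositional ℕ._≟_ using (_∈?_)
open import Data.Product using (Σ; ∃; _×_; _,_; proj₁; proj₂)
open import Data.Product.Properties using (≡-dec)
open import Data.Sum as Sum using (_⊎_; inj₁; inj₂; [_,_]′)
open import Data.Unit using (⊤)
open import Function using (_∘_; id)
open import Function.Bundles using (Equivalence)
open import Relation.Binary using (Rel; IsTotalOrder; Symmetric)
open import Relation.Binary.Construct.Closure.ReflexiveTransitive using (Star; ε; _◅_; _◅◅_; kleisliStar; gmap; reverse)
open import Relation.Binary.PropositionalEquality as ≡ using (_≡_; _≢_; refl; sym; trans; cong; cong₂; subst; subst₂)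
import Relation.Binary.Reasoning.Setoid as SetoidReasoning
open import Relation.Nullary using (¬_; Dec; yes; no; _×-dec_; _⊎-dec_)
open import Relation.Nullary.Decidable using (map′)

-- Why the recurrence is the right one: at a leaf `v` of mark (1,0) joined to `u` of mark (w,d),
-- deleting `uv` isolates `v` and splits off φ(1,0), contracting `uv` gives `u` the mark (w+1,d+1),
-- and absorbing gives it (w+1,d). Only the block containing `u` sees the difference, and since `∔`
-- adds `w` and 1+d, that block needs the same recurrence, read at its own total mark.
--
-- Two obstacles shape the proof. The product over blocks is written as a product over
-- representatives in list order, and neither their choice nor their order is respected by
-- contraction or restriction; such products are therefore compared along a relation "lies in the
-- corresponding block", and marks through two additive statistics. Secondly, the recursion
-- contracts and deletes all pendant edges in one go, with identifiers renamed on the way, whereas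
-- the argument handles one edge at a time. The bridge is that contracting a pendant edge renames
-- the remaining edges injectively and leaves the other listed edges pendant.

T-ext : ∀ {a b} → (T a → T b) → (T b → T a) → a ≡ b
T-ext {true}  {true}  f g = refl
T-ext {true}  {false} f g = ⊥-elim (f _)
T-ext {false} {true}  f g = ⊥-elim (g _)
T-ext {false} {false} f g = refl

T-not⁺ : ∀ {b} → ¬ T b → T (not b)
T-not⁺ {true}  f = f _
T-not⁺ {false} f = _

T-not⁻ : ∀ {b} → T (not b) → ¬ T b
T-not⁻ {false} _ ()

∧⁺ : ∀ {a b} → T a → T b → T (a ∧ b)
∧⁺ p q = Equivalence.from T-∧ (p , q)

∧⁻ : ∀ {a b} → T (a ∧ b) → T a × T b
∧⁻ = Equivalence.to T-∧

∨⁺ : ∀ {a b} → T a ⊎ T b → T (a ∨ b)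
∨⁺ = Equivalence.from T-∨

∨⁻ : ∀ {a b} → T (a ∨ b) → T a ⊎ T b
∨⁻ = Equivalence.to T-∨

≡ᵇ-refl : ∀ x → T (x ≡ᵇ x)
≡ᵇ-refl x = ≡⇒≡ᵇ x x refl

-- Lists filtered by Boolean predicates

module _ {a} {A : Set a} where

  ∈-filterᵇ⁺ : ∀ (p : A → Bool) {x xs} → x ∈ xs → T (p x) → x ∈ filterᵇ p xs
  ∈-filterᵇ⁺ p = ∈-filter⁺ (T? ∘ p)

  ∈-filterᵇ⁻ : ∀ (p : A → Bool) {x xs} → x ∈ filterᵇ p xs → x ∈ xs × T (p x)
  ∈-filterᵇ⁻ p = ∈-filter⁻ (T? ∘ p)

  filterᵇ-cong : ∀ {p q : A → Bool} xs → (∀ {x} → x ∈ xs → p x ≡ q x) → filterᵇ p xs ≡ filterᵇ q xs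
  filterᵇ-cong [] h = refl
  filterᵇ-cong {p} {q} (x ∷ xs) h rewrite h (here refl) with q x
  ... | true  = cong (x ∷_) (filterᵇ-cong xs (h ∘ there))
  ... | false = filterᵇ-cong xs (h ∘ there)

  filterᵇ-filterᵇ : ∀ (p q : A → Bool) xs → filterᵇ p (filterᵇ q xs) ≡ filterᵇ (λ x → q x ∧ p x) xs
  filterᵇ-filterᵇ p q [] = refl
  filterᵇ-filterᵇ p q (x ∷ xs) with q x
  ... | false = filterᵇ-filterᵇ p q xs
  ... | true with p x
  ...   | true  = cong (x ∷_) (filterᵇ-filterᵇ p q xs)
  ...   | false = filterᵇ-filterᵇ p q xs

  filterᵇ-all : ∀ (p : A → Bool) xs → (∀ {x} → x ∈ xs → T (p x)) → filterᵇ p xs ≡ xs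
  filterᵇ-all p xs h = filter-all (T? ∘ p) (All.tabulate h)

  filterᵇ-none : ∀ (p : A → Bool) xs → (∀ {x} → x ∈ xs → ¬ T (p x)) → filterᵇ p xs ≡ []
  filterᵇ-none p xs h = filter-none (T? ∘ p) (All.tabulate h)

  -- Serves the growth of reachable sets: passing from one stage to the next either changes nothing
  -- or strictly raises a count.
  filterᵇ-dichotomy : ∀ (p q : A → Bool) xs → (∀ {x} → x ∈ xs → T (p x) → T (q x)) →
    (∀ {x} → x ∈ xs → T (q x) → T (p x)) ⊎ length (filterᵇ p xs) < length (filterᵇ q xs)
  filterᵇ-dichotomy p q [] h = inj₁ λ ()
  filterᵇ-dichotomy p q (x ∷ xs) h
    with p x in px | q x in qx | filterᵇ-dichotomy p q xs (h ∘ there)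
  ... | true  | true  | inj₁ k = inj₁ λ { (here refl) _ → Equivalence.from T-≡ px ; (there m) → k m }
  ... | true  | true  | inj₂ k = inj₂ (s≤s k)
  ... | false | false | inj₁ k = inj₁ λ { (here refl) t → ⊥-elim (subst T qx t) ; (there m) → k m }
  ... | false | false | inj₂ k = inj₂ k
  ... | true  | false | _      = ⊥-elim (subst T qx (h (here refl) (Equivalence.from T-≡ px)))
  ... | false | true  | inj₁ k = inj₂ (s≤s (≤-reflexive (cong length (filterᵇ-cong xs λ m → T-ext (h (there m)) (k m)))))
  ... | false | true  | inj₂ k = inj₂ (m≤n⇒m≤1+n k)

filterᵇ-map : ∀ {a b} {A : Set a} {B : Set b} (p : B → Bool) (f : A → B) xs →
  filterᵇ p (map f xs) ≡ map f (filterᵇ (p ∘ f) xs)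
filterᵇ-map p f [] = refl
filterᵇ-map p f (x ∷ xs) with p (f x)
... | true  = cong (f x ∷_) (filterᵇ-map p f xs)
... | false = filterᵇ-map p f xs

map-cong-∈ : ∀ {a b} {A : Set a} {B : Set b} {f g : A → B} xs → (∀ {x} → x ∈ xs → f x ≡ g x) → map f xs ≡ map g xs
map-cong-∈ [] h = refl
map-cong-∈ (x ∷ xs) h = cong₂ _∷_ (h (here refl)) (map-cong-∈ xs (h ∘ there))

elem⁺ : ∀ {x xs} → x ∈ xs → T (elem x xs)
elem⁺ {x} m = any⁺ (x ≡ᵇ_) (lose m (≡ᵇ-refl x))

elem⁻ : ∀ {x xs} → T (elem x xs) → x ∈ xs
elem⁻ {x} {xs} t with find (any⁻ (x ≡ᵇ_) xs t)
... | y , m , e = subst (_∈ xs) (sym (≡ᵇ⇒≡ x y e)) m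

-- Connectivity

Nbr : List Edge → ℕ → ℕ → Set
Nbr E x y = (x , y) ∈ E ⊎ (y , x) ∈ E

Conn : List Edge → ℕ → ℕ → Set
Conn E = Star (Nbr E)

Nbr-sym : ∀ {E x y} → Nbr E x y → Nbr E y x
Nbr-sym = Sum.swap

Conn-sym : ∀ {E x y} → Conn E x y → Conn E y x
Conn-sym = reverse Nbr-sym

Endpoints : List ℕ → List Edge → Set
Endpoints is = All (λ e → proj₁ e ∈ is × proj₂ e ∈ is)

Nbr-endpoint : ∀ {is E x y} → Endpoints is E → Nbr E x y → y ∈ is
Nbr-endpoint es (inj₁ m) = proj₂ (All.lookup es m)
Nbr-endpoint es (inj₂ m) = proj₁ (All.lookup es m)

Conn-endpoint : ∀ {is E x y} → Endpoints is E → x ∈ is → Conn E x y → y ∈ is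
Conn-endpoint es m ε = m
Conn-endpoint es m (n ◅ c) = Conn-endpoint es (Nbr-endpoint es n) c

joins : ℕ → ℕ → Edge → Bool
joins x y ab = ((proj₁ ab ≡ᵇ x) ∧ (proj₂ ab ≡ᵇ y)) ∨ ((proj₁ ab ≡ᵇ y) ∧ (proj₂ ab ≡ᵇ x))

adjᵇ⁻ : ∀ {E x y} → T (adjᵇ E x y) → Nbr E x y
adjᵇ⁻ {E} {x} {y} t with find (any⁻ (joins x y) E t)
... | (a , b) , m , j with ∨⁻ j
...   | inj₁ k rewrite sym (≡ᵇ⇒≡ a x (proj₁ (∧⁻ k))) | sym (≡ᵇ⇒≡ b y (proj₂ (∧⁻ {a ≡ᵇ x} k))) = inj₁ m
...   | inj₂ k rewrite sym (≡ᵇ⇒≡ a y (proj₁ (∧⁻ k))) | sym (≡ᵇ⇒≡ b x (proj₂ (∧⁻ {a ≡ᵇ y} k))) = inj₂ m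

adjᵇ⁺ : ∀ {E x y} → Nbr E x y → T (adjᵇ E x y)
adjᵇ⁺ {E} {x} {y} (inj₁ m) = any⁺ (joins x y) (lose m (∨⁺ (inj₁ (∧⁺ (≡ᵇ-refl x) (≡ᵇ-refl y)))))
adjᵇ⁺ {E} {x} {y} (inj₂ m) = any⁺ (joins x y) (lose m (∨⁺ {(y ≡ᵇ x) ∧ (x ≡ᵇ y)} (inj₂ (∧⁺ (≡ᵇ-refl y) (≡ᵇ-refl x)))))

module _ (vs : List ℕ) (E : List Edge) where

  grows : List ℕ → ℕ → Bool
  grows S y = elem y S ∨ any (λ x → adjᵇ E x y) S

  grow⁻ : ∀ S {y} → y ∈ grow vs E S → y ∈ vs × (y ∈ S ⊎ ∃ λ x → x ∈ S × Nbr E x y)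
  grow⁻ S {y} m with ∈-filterᵇ⁻ (grows S) {xs = vs} m
  ... | y∈ , t with ∨⁻ t
  ...   | inj₁ k = y∈ , inj₁ (elem⁻ k)
  ...   | inj₂ k with find (any⁻ (λ x → adjᵇ E x y) S k)
  ...     | x , x∈ , a = y∈ , inj₂ (x , x∈ , adjᵇ⁻ a)

  grow⁺ˡ : ∀ S {y} → y ∈ vs → y ∈ S → y ∈ grow vs E S
  grow⁺ˡ S y∈ m = ∈-filterᵇ⁺ (grows S) y∈ (∨⁺ (inj₁ (elem⁺ m)))

  grow⁺ʳ : ∀ S {x y} → y ∈ vs → x ∈ S → Nbr E x y → y ∈ grow vs E S
  grow⁺ʳ S {x} {y} y∈ m a =
    ∈-filterᵇ⁺ (grows S) y∈ (∨⁺ {elem y S} (inj₂ (any⁺ (λ x → adjᵇ E x y) (lose m (adjᵇ⁺ a)))))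

  stage : ℕ → ℕ → List ℕ
  stage n v = applyN n (grow vs E) (v ∷ [])

  stage-sound : ∀ n {v y} → y ∈ stage n v → Conn E v y
  stage-sound zero (here refl) = ε
  stage-sound (suc n) {v} m with grow⁻ (stage n v) m
  ... | _ , inj₁ k = stage-sound n k
  ... | _ , inj₂ (x , k , a) = stage-sound n k ◅◅ (a ◅ ε)

  Closed : List ℕ → Set
  Closed S = ∀ {y} → y ∈ vs → y ∈ grow vs E S → y ∈ S

  covered : List ℕ → ℕ
  covered S = length (filterᵇ (λ y → elem y S) vs)

  -- Pigeonhole: as long as a stage is not closed, the next one gains a vertex. The count of covered
  -- vertices cannot exceed `length vs`, so the number of rounds used in `reach` suffices.
  stage-grows : ∀ n {v} → v ∈ vs → Closed (stage n v) ⊎ n < covered (stage n v)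
  stage-grows zero {v} v∈ = inj₂ (∈⇒0<length (∈-filterᵇ⁺ (λ y → elem y (v ∷ [])) v∈ (elem⁺ {v} {v ∷ []} (here refl))))
    where
    ∈⇒0<length : ∀ {x : ℕ} {xs} → x ∈ xs → 0 < length xs
    ∈⇒0<length (here _)  = s≤s z≤n
    ∈⇒0<length (there _) = s≤s z≤n
  stage-grows (suc n) {v} v∈ with stage-grows n v∈
  ... | inj₁ cl = inj₁ λ {y} y∈ m → case y y∈ (proj₂ (grow⁻ (grow vs E (stage n v)) m))
    where
    case : ∀ y → y ∈ vs → (y ∈ grow vs E (stage n v) ⊎ ∃ λ x → x ∈ grow vs E (stage n v) × Nbr E x y) → y ∈ grow vs E (stage n v)
    case y y∈ (inj₁ k) = k
    case y y∈ (inj₂ (x , k , a)) = grow⁺ʳ (stage n v) y∈ (cl (proj₁ (grow⁻ (stage n v) k)) k) a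
  ... | inj₂ lt with filterᵇ-dichotomy (λ y → elem y (stage n v)) (λ y → elem y (stage (suc n) v)) vs
                       (λ y∈ t → elem⁺ (grow⁺ˡ (stage n v) y∈ (elem⁻ t)))
  ...   | inj₁ k = inj₁ λ {y} y∈ m → [ id , (λ { (x , x∈ , a) → grow⁺ʳ (stage n v) y∈
                     (elem⁻ (k (proj₁ (grow⁻ (stage n v) x∈)) (elem⁺ x∈))) a }) ]′
                     (proj₂ (grow⁻ (stage (suc n) v) m))
  ...   | inj₂ k = inj₂ (≤-trans (s≤s lt) k)

  stage-closed : ∀ {v} → v ∈ vs → Closed (stage (length vs) v)
  stage-closed {v} v∈ with stage-grows (length vs) v∈
  ... | inj₁ cl = cl
  ... | inj₂ lt = ⊥-elim (<-irrefl refl (≤-trans lt (length-filter (T? ∘ λ y → elem y (stage (length vs) v)) vs)))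

  stage-start : ∀ n {v} → v ∈ vs → v ∈ stage n v
  stage-start zero v∈ = here refl
  stage-start (suc n) {v} v∈ = grow⁺ˡ (stage n v) v∈ (stage-start n v∈)

  stage-complete : Endpoints vs E → ∀ {v y} → v ∈ vs → Conn E v y → y ∈ stage (length vs) v
  stage-complete es {v} v∈ c = go (stage-start (length vs) v∈) c
    where
    go : ∀ {x y} → x ∈ stage (length vs) v → Conn E x y → y ∈ stage (length vs) v
    go m ε = m
    go m (a ◅ c) = go (stage-closed v∈ (Nbr-endpoint es a) (grow⁺ʳ (stage (length vs) v) (Nbr-endpoint es a) m a)) c

-- The part of the forest condition that block products rely on. Cycles, loops and repeated edges
-- are allowed, so it passes to every edge subset and through every renaming of `v` to another
-- vertex `u`.
record Valid (V : List Entry) (E : List Edge) : Set where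
  constructor mkValid
  field
    unique-ids : Unique (map proj₁ V)
    endpoints  : Endpoints (map proj₁ V) E
open Valid public

connᵇ : List Entry → List Edge → ℕ → ℕ → Bool
connᵇ V E x y = elem y (reach (graph V E) x)

connᵇ⁻ : ∀ V E x y → T (connᵇ V E x y) → Conn E x y
connᵇ⁻ V E x y t = stage-sound (map proj₁ V) E (length (map proj₁ V)) (elem⁻ t)

connᵇ⁺ : ∀ {V E} → Valid V E → ∀ {x} y → x ∈ map proj₁ V → Conn E x y → T (connᵇ V E x y)
connᵇ⁺ {V} {E} va y m c = elem⁺ (stage-complete (map proj₁ V) E (endpoints va) m c)

-- Representatives and component marks

module _ {V : List Entry} {E : List Edge} (va : Valid V E) where
  private G = graph V E

  repsFrom-⊆ : ∀ prev vs {r} → r ∈ repsFrom G prev vs → r ∈ vs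
  repsFrom-⊆ prev (v ∷ vs) m with any (λ p → elem p (reach G (proj₁ v))) prev
  repsFrom-⊆ prev (v ∷ vs) m | true = there (repsFrom-⊆ _ vs m)
  repsFrom-⊆ prev (v ∷ vs) (here e) | false = here e
  repsFrom-⊆ prev (v ∷ vs) (there m) | false = there (repsFrom-⊆ _ vs m)

  repsFrom-unrelated : ∀ prev vs → (∀ {x} → x ∈ vs → x ∈ V) → ∀ {r p} →
    r ∈ repsFrom G prev vs → p ∈ prev → ¬ Conn E (proj₁ r) p
  repsFrom-unrelated prev (v ∷ vs) sub m p∈ c with any (λ p → elem p (reach G (proj₁ v))) prev in eq
  repsFrom-unrelated prev (v ∷ vs) sub m p∈ c | true = repsFrom-unrelated _ vs (sub ∘ there) m (∈-++⁺ˡ p∈) c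
  repsFrom-unrelated prev (v ∷ vs) sub (there m) p∈ c | false = repsFrom-unrelated _ vs (sub ∘ there) m (∈-++⁺ˡ p∈) c
  repsFrom-unrelated prev (v ∷ vs) sub (here refl) p∈ c | false =
    subst T eq (any⁺ (λ p → elem p (reach G (proj₁ v))) (lose p∈ (connᵇ⁺ va _ (∈-map⁺ proj₁ (sub (here refl))) c)))

  -- `prev` contains every vertex already visited, including those that were skipped; hence the
  -- first alternative, which is empty at the start, where `prev` is `[]`.
  repsFrom-cover : ∀ prev vs {x} → x ∈ vs →
    (∃ λ p → p ∈ prev × Conn E (proj₁ x) p) ⊎ (∃ λ r → r ∈ repsFrom G prev vs × Conn E (proj₁ x) (proj₁ r))
  repsFrom-cover prev (v ∷ vs) x∈ with any (λ p → elem p (reach G (proj₁ v))) prev in eq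
  repsFrom-cover prev (v ∷ vs) x∈ | true
    with find (any⁻ (λ p → elem p (reach G (proj₁ v))) prev (subst T (sym eq) _))
  repsFrom-cover prev (v ∷ vs) (here refl) | true | p , p∈ , t = inj₁ (p , p∈ , connᵇ⁻ V E _ _ t)
  repsFrom-cover prev (v ∷ vs) (there x∈) | true | p , p∈ , t with repsFrom-cover (prev ∷ʳ proj₁ v) vs x∈
  ... | inj₂ k = inj₂ k
  ... | inj₁ (q , q∈ , c) with ∈-++⁻ prev q∈
  ...   | inj₁ m = inj₁ (q , m , c)
  -- The vertex found is the skipped `v`, which is no representative; the path continues to the
  -- earlier `p` that caused the skip.
  ...   | inj₂ (here refl) = inj₁ (p , p∈ , c ◅◅ connᵇ⁻ V E _ _ t)
  repsFrom-cover prev (v ∷ vs) (here refl) | false = inj₂ (v , here refl , ε)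
  repsFrom-cover prev (v ∷ vs) (there x∈) | false with repsFrom-cover (prev ∷ʳ proj₁ v) vs x∈
  ... | inj₂ (r , r∈ , c) = inj₂ (r , there r∈ , c)
  ... | inj₁ (q , q∈ , c) with ∈-++⁻ prev q∈
  ...   | inj₁ m = inj₁ (q , m , c)
  ...   | inj₂ (here refl) = inj₂ (v , here refl , c)

  repsFrom-pairs : ∀ prev vs → (∀ {x} → x ∈ vs → x ∈ V) →
    AllPairs (λ r s → ¬ Conn E (proj₁ r) (proj₁ s)) (repsFrom G prev vs)
  repsFrom-pairs prev [] sub = []
  repsFrom-pairs prev (v ∷ vs) sub with any (λ p → elem p (reach G (proj₁ v))) prev
  ... | true  = repsFrom-pairs _ vs (sub ∘ there)
  ... | false = All.tabulate (λ r∈ c → repsFrom-unrelated (prev ∷ʳ proj₁ v) vs (sub ∘ there) r∈ (∈-++⁺ʳ prev (here refl)) (Conn-sym c))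
                ∷ repsFrom-pairs _ vs (sub ∘ there)

  reps-⊆ : ∀ {r} → r ∈ reps G → r ∈ V
  reps-⊆ = repsFrom-⊆ [] V

  reps-cover : ∀ {i} → i ∈ map proj₁ V → ∃ λ r → r ∈ reps G × Conn E i (proj₁ r)
  reps-cover i∈ with ∈-map⁻ proj₁ i∈
  ... | x , x∈ , refl with repsFrom-cover [] V x∈
  ...   | inj₂ k = k

  reps-pairs : AllPairs (λ r s → ¬ Conn E (proj₁ r) (proj₁ s)) (reps G)
  reps-pairs = repsFrom-pairs [] V id

-- Applied to statistics `t` that turn `∔` into addition. The mark of a component then becomes a
-- pair of plain sums, which forget the order of the dot-sum and the chosen representative.
mass : (Mark → ℕ) → (ℕ → Bool) → List Entry → ℕ
mass t p []            = 0
mass t p ((i , m) ∷ V) = (if p i then t m else 0) + mass t p V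

module _ (t : Mark → ℕ) where

  mass-cong : ∀ {p q} V → (∀ {i} → i ∈ map proj₁ V → p i ≡ q i) → mass t p V ≡ mass t q V
  mass-cong [] h = refl
  mass-cong ((i , m) ∷ V) h = cong₂ _+_ (cong (if_then t m else 0) (h (here refl))) (mass-cong V (h ∘ there))

  mass-filterᵇ : ∀ p q V → mass t p (filterᵇ (q ∘ proj₁) V) ≡ mass t (λ i → q i ∧ p i) V
  mass-filterᵇ p q [] = refl
  mass-filterᵇ p q ((i , m) ∷ V) with q i
  ... | true  = cong ((if p i then t m else 0) +_) (mass-filterᵇ p q V)
  ... | false = mass-filterᵇ p q V

  mass-++ : ∀ p U V → mass t p (U ++ V) ≡ mass t p U + mass t p V
  mass-++ p [] V = refl
  mass-++ p ((i , m) ∷ U) V = trans (cong ((if p i then t m else 0) +_) (mass-++ p U V)) (sym (ℕ.+-assoc (if p i then t m else 0) _ _))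

  mass-zipper : ∀ p U₁ {u m} U₂ →
    mass t p (U₁ ++ (u , m) ∷ U₂) ≡ (if p u then t m else 0) + mass t p (U₁ ++ U₂)
  mass-zipper p U₁ {u} {m} U₂ rewrite mass-++ p U₁ ((u , m) ∷ U₂) | mass-++ p U₁ U₂ =
    trans (sym (ℕ.+-assoc (mass t p U₁) x _)) (trans (cong (_+ mass t p U₂) (ℕ.+-comm (mass t p U₁) x)) (ℕ.+-assoc x _ _))
    where
    x = if p u then t m else 0

  mass-remove : ∀ p {V v m} → Unique (map proj₁ V) → (v , m) ∈ V →
    mass t p V ≡ (if p v then t m else 0) + mass t (λ i → not (i ≡ᵇ v) ∧ p i) V
  mass-remove p {(i , m) ∷ V} (u ∷ us) (here refl)
    rewrite Equivalence.to T-≡ (≡ᵇ-refl i) =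
    cong ((if p i then t m else 0) +_) (mass-cong V λ {j} j∈ →
      sym (cong (_∧ p j) (Equivalence.to T-≡ (T-not⁺ {j ≡ᵇ i} λ e → All.lookup u j∈ (sym (≡ᵇ⇒≡ j i e))))))
  mass-remove p {(i , n) ∷ V} {v} {m} (u ∷ us) (there v∈)
    rewrite Equivalence.to T-≡ (T-not⁺ {i ≡ᵇ v} λ e → All.lookup u (∈-map⁺ proj₁ v∈) (≡ᵇ⇒≡ i v e))
          | mass-remove p us v∈ =
    trans (sym (ℕ.+-assoc a b _)) (trans (cong (_+ mass t (λ i → not (i ≡ᵇ v) ∧ p i) V) (ℕ.+-comm a b)) (ℕ.+-assoc b a _))
    where
    a = if p i then t n else 0
    b = if p v then t m else 0

  foldr-additive : (∀ a b → t (a ∔ b) ≡ t a + t b) → ∀ p m V →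
    t (foldr (λ e n → proj₂ e ∔ n) m (filterᵇ (p ∘ proj₁) V)) ≡ t m + mass t p V
  foldr-additive add p m [] = sym (ℕ.+-identityʳ (t m))
  foldr-additive add p m ((i , n) ∷ V) with p i
  ... | false = foldr-additive add p m V
  ... | true  = trans (add n _) (trans (cong (t n +_) (foldr-additive add p m V))
                  (trans (sym (ℕ.+-assoc (t n) (t m) _)) (trans (cong (_+ mass t p V) (ℕ.+-comm (t n) (t m))) (ℕ.+-assoc (t m) (t n) _))))

  -- `compMark` starts its fold at the mark of `v` and skips `v` in the list; `mass-remove` takes
  -- `v` out of the sum in the same way.
  compMark-mass : (∀ a b → t (a ∔ b) ≡ t a + t b) → ∀ {V E} → Valid V E → ∀ {v} → v ∈ V →
    t (compMark (graph V E) v) ≡ mass t (connᵇ V E (proj₁ v)) V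
  compMark-mass add {V} {E} va {v , m} v∈ = trans
    (foldr-additive add (λ i → connᵇ V E v i ∧ not (i ≡ᵇ v)) m V)
    (sym (trans (mass-remove (connᵇ V E v) (unique-ids va) v∈)
      (cong₂ _+_ (cong (if_then t m else 0) (Equivalence.to T-≡ (connᵇ⁺ va v (∈-map⁺ proj₁ v∈) ε)))
                 (mass-cong V λ {i} _ → ∧-comm (not (i ≡ᵇ v)) (connᵇ V E v i)))))

-- Unlike d itself, 1 + d is additive under ∔.
1+d : Mark → ℕ
1+d m = suc (d m)

∔-1+d : ∀ a b → 1+d (a ∔ b) ≡ 1+d a + 1+d b
∔-1+d (mark _ d _) (mark _ d′ _) = cong suc (sym (ℕ.+-suc d d′))

∔-w : ∀ a b → w (a ∔ b) ≡ w a + w b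
∔-w _ _ = refl

-- Merging two vertices

mark-unique : ∀ {V : List Entry} {i m n} → Unique (map proj₁ V) → (i , m) ∈ V → (i , n) ∈ V → m ≡ n
mark-unique (u ∷ us) (here refl) (here refl) = refl
mark-unique (u ∷ us) (here refl) (there m) = ⊥-elim (All.lookup u (∈-map⁺ proj₁ m) refl)
mark-unique (u ∷ us) (there m) (here refl) = ⊥-elim (All.lookup u (∈-map⁺ proj₁ m) refl)
mark-unique (u ∷ us) (there m) (there n) = mark-unique us m n

markOf-∈ : ∀ {V i m} → Unique (map proj₁ V) → (i , m) ∈ V → markOf V i ≡ just m
markOf-∈ {(i , m) ∷ V} (u ∷ us) (here refl) rewrite Equivalence.to T-≡ (≡ᵇ-refl i) = refl
markOf-∈ {(j , n) ∷ V} {i} (u ∷ us) (there i∈) with j ≡ᵇ i in eq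
... | true  = ⊥-elim (All.lookup u (∈-map⁺ proj₁ i∈) (≡ᵇ⇒≡ j i (Equivalence.from T-≡ eq)))
... | false = markOf-∈ us i∈

updAt : ℕ → (Mark → Mark) → Entry → Entry
updAt u g (j , m) = if j ≡ᵇ u then (j , g m) else (j , m)

updAt-other : ∀ u g V → u ∉ map proj₁ V → map (updAt u g) V ≡ V
updAt-other u g [] u∉ = refl
updAt-other u g ((j , m) ∷ V) u∉ with j ≡ᵇ u in eq
... | true  = ⊥-elim (u∉ (here (sym (≡ᵇ⇒≡ j u (Equivalence.from T-≡ eq)))))
... | false = cong ((j , m) ∷_) (updAt-other u g V (u∉ ∘ there))

-- The decomposition is fixed before `g`, so keeping, absorbing or dot-summing the mark of `u`
-- yields lists that differ visibly in a single entry.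
updAt-zipper : ∀ {V u m} → Unique (map proj₁ V) → (u , m) ∈ V →
  ∃ λ U₁ → ∃ λ U₂ → V ≡ U₁ ++ (u , m) ∷ U₂ × (∀ g → map (updAt u g) V ≡ U₁ ++ (u , g m) ∷ U₂)
updAt-zipper {(u , m) ∷ V} (f ∷ us) (here refl) = [] , V , refl , λ g → eq g
  where
  eq : ∀ g → map (updAt u g) ((u , m) ∷ V) ≡ (u , g m) ∷ V
  eq g rewrite Equivalence.to T-≡ (≡ᵇ-refl u) = cong ((u , g m) ∷_) (updAt-other u g V λ u∈ → All.lookup f u∈ refl)
updAt-zipper {(j , n) ∷ V} {u} {m} (f ∷ us) (there u∈) with updAt-zipper us u∈
... | U₁ , U₂ , e , h = (j , n) ∷ U₁ , U₂ , cong ((j , n) ∷_) e , eq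
  where
  eq : ∀ g → map (updAt u g) ((j , n) ∷ V) ≡ (j , n) ∷ U₁ ++ (u , g m) ∷ U₂
  eq g with j ≡ᵇ u in q
  ... | true  = ⊥-elim (All.lookup f (∈-map⁺ proj₁ u∈) (≡ᵇ⇒≡ j u (Equivalence.from T-≡ q)))
  ... | false = cong ((j , n) ∷_) (h g)

without : ℕ → List Entry → List Entry
without v = filterᵇ (λ e → not (proj₁ e ≡ᵇ v))

mergeV : (Mark → Mark) → ℕ → ℕ → List Entry → List Entry
mergeV g u v V = map (updAt u g) (without v V)

eitherWay : ℕ → ℕ → Edge → Bool
eitherWay u v e = eqE e (u , v) ∨ eqE e (v , u)

dropE : ℕ → ℕ → List Edge → List Edge
dropE u v = filterᵇ (λ e → not (eitherWay u v e))

mergeWith-≡ : ∀ f u v {V E m} → Unique (map proj₁ V) → (v , m) ∈ V →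
  mergeWith f u v (graph V E) ≡ graph (mergeV (λ n → f n m) u v V) (map (renameE u v) (dropE u v E))
mergeWith-≡ f u v {V} {E} {m} us v∈ with markOf V v | markOf-∈ us v∈
... | just .m | refl = cong (λ z → graph z (map (renameE u v) (dropE u v E))) (map-cong (λ { (j , n) → refl }) (without v V))

ids-updAt : ∀ u g V → map proj₁ (map (updAt u g) V) ≡ map proj₁ V
ids-updAt u g [] = refl
ids-updAt u g ((j , m) ∷ V) with j ≡ᵇ u
... | true  = cong (j ∷_) (ids-updAt u g V)
... | false = cong (j ∷_) (ids-updAt u g V)

ids-without : ∀ v V → map proj₁ (without v V) ≡ filterᵇ (λ i → not (i ≡ᵇ v)) (map proj₁ V)
ids-without v V = sym (filterᵇ-map (λ i → not (i ≡ᵇ v)) proj₁ V)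

ids-mergeV : ∀ g u v V → map proj₁ (mergeV g u v V) ≡ filterᵇ (λ i → not (i ≡ᵇ v)) (map proj₁ V)
ids-mergeV g u v V = trans (ids-updAt u g (without v V)) (ids-without v V)

Unique-filterᵇ : ∀ {A : Set} (p : A → Bool) {xs} → Unique xs → Unique (filterᵇ p xs)
Unique-filterᵇ p = AllPairs.filter⁺ (T? ∘ p)

renameV-≡ : ∀ u v → renameV u v v ≡ u
renameV-≡ u v rewrite Equivalence.to T-≡ (≡ᵇ-refl v) = refl

renameV-≢ : ∀ u v {x} → x ≢ v → renameV u v x ≡ x
renameV-≢ u v {x} ne with x ≡ᵇ v in eq
... | true  = ⊥-elim (ne (≡ᵇ⇒≡ x v (Equivalence.from T-≡ eq)))
... | false = refl

-- The share of `v` moves into the entry of `u`; before the merge it is counted exactly when the new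
-- name of `v`, namely `u`, satisfies `p`.
mass-mergeV : ∀ t → (∀ a b → t (a ∔ b) ≡ t a + t b) → ∀ {V u v mu mv} p → Unique (map proj₁ V) →
  (u , mu) ∈ V → (v , mv) ∈ V → u ≢ v →
  mass t p (mergeV (λ n → n ∔ mv) u v V) ≡ mass t (p ∘ renameV u v) V
mass-mergeV t add {V} {u} {v} {mu} {mv} p us u∈ v∈ u≢v
  with updAt-zipper (subst Unique (sym (ids-without v V)) (Unique-filterᵇ _ us))
         (∈-filterᵇ⁺ (λ e → not (proj₁ e ≡ᵇ v)) u∈ (T-not⁺ λ e → u≢v (≡ᵇ⇒≡ u v e)))
... | U₁ , U₂ , e , h =
  trans (cong (mass t p) (h _))
  (trans (mass-zipper t p U₁ U₂)
  (trans (cong (_+ mass t p (U₁ ++ U₂)) (split (p u)))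
  (trans (ℕ.+-assoc (if p u then t mv else 0) _ _)
  (trans (cong ((if p u then t mv else 0) +_) (trans (sym (mass-zipper t p U₁ U₂)) (trans (cong (mass t p) (sym e))
    (trans (mass-filterᵇ t p (λ i → not (i ≡ᵇ v)) V) (mass-cong t V λ {i} _ → agree i)))))
  (sym (trans (mass-remove t (p ∘ renameV u v) us v∈)
    (cong (λ x → (if p x then t mv else 0) + mass t (λ i → not (i ≡ᵇ v) ∧ p (renameV u v i)) V) (renameV-≡ u v))))))))
  where
  split : ∀ b → (if b then t (mu ∔ mv) else 0) ≡ (if b then t mv else 0) + (if b then t mu else 0)
  split true  = trans (add mu mv) (ℕ.+-comm (t mu) (t mv))
  split false = refl
  agree : ∀ i → not (i ≡ᵇ v) ∧ p i ≡ not (i ≡ᵇ v) ∧ p (renameV u v i)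
  agree i with i ≡ᵇ v
  ... | true  = refl
  ... | false = refl

-- Connectivity under contraction and restriction

renameV-self : ∀ u v → renameV u v u ≡ u
renameV-self u v with u ≡ᵇ v
... | true  = refl
... | false = refl

Conn-mono : ∀ {A B x y} → (∀ {e} → e ∈ A → e ∈ B) → Conn A x y → Conn B x y
Conn-mono sub = gmap id (Sum.map sub sub)

module _ (u v : ℕ) (A : List Edge) where

  conn-rename⁺ : ∀ {x y} → Conn ((u , v) ∷ A) x y →
    Conn (map (renameE u v) A) (renameV u v x) (renameV u v y)
  conn-rename⁺ = kleisliStar (renameV u v) hop
    where
    uv : renameV u v u ≡ renameV u v v
    uv = trans (renameV-self u v) (sym (renameV-≡ u v))
    hop : ∀ {x y} → Nbr ((u , v) ∷ A) x y → Conn (map (renameE u v) A) (renameV u v x) (renameV u v y)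
    hop (inj₁ (here refl)) = subst (Conn (map (renameE u v) A) (renameV u v u)) uv ε
    hop (inj₂ (here refl)) = subst (λ z → Conn (map (renameE u v) A) z (renameV u v u)) uv ε
    hop (inj₁ (there m)) = inj₁ (∈-map⁺ (renameE u v) m) ◅ ε
    hop (inj₂ (there m)) = inj₂ (∈-map⁺ (renameE u v) m) ◅ ε

  conn-renamed : ∀ x → Conn ((u , v) ∷ A) (renameV u v x) x
  conn-renamed x with x ≡ᵇ v in eq
  ... | true  = subst (Conn _ _) (sym (≡ᵇ⇒≡ x v (Equivalence.from T-≡ eq))) (inj₁ (here refl) ◅ ε)
  ... | false = ε

  -- An edge of the contracted graph lifts to a walk: the original edge, with a possible detour
  -- along `uv` at either end.
  conn-rename⁻ : ∀ {x y} → Conn (map (renameE u v) A) x y → Conn ((u , v) ∷ A) x y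
  conn-rename⁻ = kleisliStar id hop
    where
    edge : ∀ {x y} → (x , y) ∈ map (renameE u v) A → Conn ((u , v) ∷ A) x y
    edge m with ∈-map⁻ (renameE u v) m
    ... | (a , b) , ab∈ , refl =
      conn-renamed a ◅◅ (inj₁ (there ab∈) ◅ Conn-sym (conn-renamed b))
    hop : ∀ {x y} → Nbr (map (renameE u v) A) x y → Conn ((u , v) ∷ A) x y
    hop (inj₁ m) = edge m
    hop (inj₂ m) = Conn-sym (edge m)

restrictV : (ℕ → Bool) → List Entry → List Entry
restrictV p = filterᵇ (p ∘ proj₁)

restrictE : (ℕ → Bool) → List Edge → List Edge
restrictE p = filterᵇ (p ∘ proj₁)

-- Says that `p` selects a union of components. This is what makes it harmless that `restrictE`
-- tests only the first endpoint of an edge.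
Saturated : (ℕ → Bool) → List Edge → Set
Saturated p = All (λ e → p (proj₁ e) ≡ p (proj₂ e))

restrictV-∈⁺ : ∀ p {V i} → i ∈ map proj₁ V → T (p i) → i ∈ map proj₁ (restrictV p V)
restrictV-∈⁺ p {V} {i} i∈ t = subst (i ∈_) (filterᵇ-map p proj₁ V) (∈-filterᵇ⁺ p i∈ t)

restrictV-∈⁻ : ∀ p {V i} → i ∈ map proj₁ (restrictV p V) → i ∈ map proj₁ V × T (p i)
restrictV-∈⁻ p {V} {i} i∈ = ∈-filterᵇ⁻ p (subst (i ∈_) (sym (filterᵇ-map p proj₁ V)) i∈)

module _ {p : ℕ → Bool} {A : List Edge} (sat : Saturated p A) where

  Nbr-saturated : ∀ {x y} → Nbr A x y → p x ≡ p y
  Nbr-saturated (inj₁ m) = All.lookup sat m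
  Nbr-saturated (inj₂ m) = sym (All.lookup sat m)

  Conn-saturated : ∀ {x y} → Conn A x y → p x ≡ p y
  Conn-saturated ε = refl
  Conn-saturated (n ◅ c) = trans (Nbr-saturated n) (Conn-saturated c)

  Conn-restrict : ∀ {x y} → Conn A x y → T (p x) → Conn (restrictE p A) x y
  Conn-restrict ε t = ε
  Conn-restrict (n ◅ c) t = hop n ◅ Conn-restrict c (subst T (Nbr-saturated n) t)
    where
    hop : Nbr A _ _ → Nbr (restrictE p A) _ _
    hop (inj₁ m) = inj₁ (∈-filterᵇ⁺ (p ∘ proj₁) m t)
    hop (inj₂ m) = inj₂ (∈-filterᵇ⁺ (p ∘ proj₁) m (subst T (Nbr-saturated n) t))

Conn-unrestrict : ∀ p {A x y} → Conn (restrictE p A) x y → Conn A x y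
Conn-unrestrict p = Conn-mono (λ m → proj₁ (∈-filterᵇ⁻ (p ∘ proj₁) m))

Saturated-not : ∀ {p A} → Saturated p A → Saturated (not ∘ p) A
Saturated-not = All.map (cong not)

Valid-restrict : ∀ {p V A} → Saturated p A → Valid V A → Valid (restrictV p V) (restrictE p A)
Valid-restrict {p} {V} {A} sat va = mkValid
  (subst Unique (filterᵇ-map p proj₁ V) (Unique-filterᵇ p (unique-ids va)))
  (All.tabulate λ m → let (e∈ , t) = ∈-filterᵇ⁻ (p ∘ proj₁) {xs = A} m ; (a∈ , b∈) = All.lookup (endpoints va) e∈ in
    restrictV-∈⁺ p a∈ t , restrictV-∈⁺ p b∈ (subst T (All.lookup sat e∈) t))

Valid-⊆ : ∀ {V A B} → (∀ {e} → e ∈ B → e ∈ A) → Valid V A → Valid V B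
Valid-⊆ sub va = mkValid (unique-ids va) (All.tabulate λ m → All.lookup (endpoints va) (sub m))

mergeV-∈⁺ : ∀ g {u v V i} → i ∈ map proj₁ V → i ≢ v → i ∈ map proj₁ (mergeV g u v V)
mergeV-∈⁺ g {u} {v} {V} {i} i∈ ne = subst (i ∈_) (sym (ids-mergeV g u v V))
  (∈-filterᵇ⁺ (λ i → not (i ≡ᵇ v)) i∈ (T-not⁺ λ e → ne (≡ᵇ⇒≡ i v e)))

mergeV-∈⁻ : ∀ g {u v V i} → i ∈ map proj₁ (mergeV g u v V) → i ∈ map proj₁ V × i ≢ v
mergeV-∈⁻ g {u} {v} {V} {i} i∈ with ∈-filterᵇ⁻ (λ i → not (i ≡ᵇ v)) (subst (i ∈_) (ids-mergeV g u v V) i∈)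
... | m , t = m , λ { refl → T-not⁻ t (≡ᵇ-refl i) }

rename-∈ : ∀ g {u v V i} → u ∈ map proj₁ V → u ≢ v → i ∈ map proj₁ V → renameV u v i ∈ map proj₁ (mergeV g u v V)
rename-∈ g {u} {v} {V} {i} u∈ u≢v i∈ with i ≡ᵇ v in eq
... | true  = mergeV-∈⁺ g {V = V} u∈ u≢v
... | false = mergeV-∈⁺ g {V = V} i∈ (λ { refl → subst T eq (≡ᵇ-refl i) })

Valid-merge : ∀ g {u v V A} → u ∈ map proj₁ V → u ≢ v → Valid V A → Valid (mergeV g u v V) (map (renameE u v) A)
Valid-merge g {u} {v} {V} u∈ u≢v va = mkValid
  (subst Unique (sym (ids-mergeV g u v V)) (Unique-filterᵇ _ (unique-ids va)))
  (All.map⁺ (All.map (λ { (a , b) → rename-∈ g {V = V} u∈ u≢v a , rename-∈ g {V = V} u∈ u≢v b }) (endpoints va)))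

-- The selection of representatives with the marks stripped off. It reads only identifiers and
-- reachability, so vertex lists that differ in marks alone have the same representatives.
repIdsFrom : (ℕ → List ℕ) → List ℕ → List ℕ → List ℕ
repIdsFrom r prev []       = []
repIdsFrom r prev (v ∷ vs) =
  if any (λ p → elem p (r v)) prev then repIdsFrom r (prev ∷ʳ v) vs else v ∷ repIdsFrom r (prev ∷ʳ v) vs

ids-repsFrom : ∀ G prev vs → map proj₁ (repsFrom G prev vs) ≡ repIdsFrom (reach G) prev (map proj₁ vs)
ids-repsFrom G prev [] = refl
ids-repsFrom G prev (v ∷ vs) with any (λ p → elem p (reach G (proj₁ v))) prev
... | true  = ids-repsFrom G _ vs
... | false = cong (proj₁ v ∷_) (ids-repsFrom G _ vs)

ids-reps : ∀ V A → map proj₁ (reps (graph V A)) ≡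
  repIdsFrom (stage (map proj₁ V) A (length (map proj₁ V))) [] (map proj₁ V)
ids-reps V A = ids-repsFrom (graph V A) [] V

ids-reps-cong : ∀ {V V′} A → map proj₁ V ≡ map proj₁ V′ → map proj₁ (reps (graph V A)) ≡ map proj₁ (reps (graph V′ A))
ids-reps-cong {V} {V′} A e = trans (ids-reps V A)
  (trans (cong (λ is → repIdsFrom (stage is A (length is)) [] is) e) (sym (ids-reps V′ A)))

connᵇ-cong : ∀ {V V′} A i j → map proj₁ V ≡ map proj₁ V′ → connᵇ V A i j ≡ connᵇ V′ A i j
connᵇ-cong A i j e = cong (λ is → elem j (stage is A (length is) i)) e

-- Finite sums and products in a commutative ring, and sums over edge subsets

module Sums {c ℓ : Level} (R : CommutativeRing c ℓ) where
  open CommutativeRing R renaming (_+_ to _+ᵣ_; _*_ to _*ᵣ_; refl to ≈-refl; sym to ≈-sym; trans to ≈-trans; reflexive to ≈-reflexive)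
  open WithRing R using (sumR; prodR) public
  open SetoidReasoning setoid

  sumR-++ : ∀ xs ys → sumR (xs ++ ys) ≈ sumR xs +ᵣ sumR ys
  sumR-++ [] ys = ≈-sym (+-identityˡ _)
  sumR-++ (x ∷ xs) ys = ≈-trans (+-congˡ (sumR-++ xs ys)) (≈-sym (+-assoc _ _ _))

  prodR-++ : ∀ xs ys → prodR (xs ++ ys) ≈ prodR xs *ᵣ prodR ys
  prodR-++ [] ys = ≈-sym (*-identityˡ _)
  prodR-++ (x ∷ xs) ys = ≈-trans (*-congˡ (prodR-++ xs ys)) (≈-sym (*-assoc _ _ _))

  *-exchange : ∀ x y z → x *ᵣ (y *ᵣ z) ≈ y *ᵣ (x *ᵣ z)
  *-exchange x y z = ≈-trans (≈-sym (*-assoc x y z)) (≈-trans (*-congʳ (*-comm x y)) (*-assoc y x z))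

  +-interchange : ∀ a b c d → (a +ᵣ b) +ᵣ (c +ᵣ d) ≈ (a +ᵣ c) +ᵣ (b +ᵣ d)
  +-interchange a b c d = begin
    (a +ᵣ b) +ᵣ (c +ᵣ d)   ≈⟨ +-assoc a b _ ⟩
    a +ᵣ (b +ᵣ (c +ᵣ d))   ≈⟨ +-congˡ (+-assoc b c d) ⟨
    a +ᵣ ((b +ᵣ c) +ᵣ d)   ≈⟨ +-congˡ (+-congʳ (+-comm b c)) ⟩
    a +ᵣ ((c +ᵣ b) +ᵣ d)   ≈⟨ +-congˡ (+-assoc c b d) ⟩
    a +ᵣ (c +ᵣ (b +ᵣ d))   ≈⟨ +-assoc a c _ ⟨
    (a +ᵣ c) +ᵣ (b +ᵣ d)   ∎

  prodR-shift : ∀ {B : Set} (h : B → Carrier) ys {y} zs →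
    prodR (map h (ys ++ y ∷ zs)) ≈ h y *ᵣ prodR (map h (ys ++ zs))
  prodR-shift h [] zs = ≈-refl
  prodR-shift h (x ∷ ys) {y} zs = ≈-trans (*-congˡ (prodR-shift h ys zs)) (*-exchange (h x) (h y) _)

  prodR-cong : ∀ {B : Set} {f g : B → Carrier} xs → (∀ {x} → x ∈ xs → f x ≈ g x) → prodR (map f xs) ≈ prodR (map g xs)
  prodR-cong [] h = ≈-refl
  prodR-cong (x ∷ xs) h = *-cong (h (here refl)) (prodR-cong xs (h ∘ there))

  -- The hypotheses make ρ restrict to a bijection between L and M.
  prodR-match : ∀ {A B : Set} (ρ : A → B → Set) {g : A → Carrier} {h : B → Carrier} L M →
    (∀ {x} → x ∈ L → ∃ λ y → y ∈ M × ρ x y) →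
    (∀ {y} → y ∈ M → ∃ λ x → x ∈ L × ρ x y) →
    AllPairs (λ x x′ → ∀ y → ρ x y → ρ x′ y → ⊥) L →
    AllPairs (λ y y′ → ∀ x → ρ x y → ρ x y′ → ⊥) M →
    (∀ {x y} → x ∈ L → y ∈ M → ρ x y → g x ≈ h y) →
    prodR (map g L) ≈ prodR (map h M)
  prodR-match ρ [] [] _ _ _ _ _ = ≈-refl
  prodR-match ρ [] (y ∷ M) _ back _ _ _ with back (here refl)
  ... | _ , () , _
  prodR-match {A} {B} ρ {g} {h} (x ∷ L) M fwd back (px ∷ pL) pM eq with fwd (here refl)
  ... | y , y∈ , r with ∈-∃++ y∈
  ...   | M₁ , M₂ , refl = begin
    g x *ᵣ prodR (map g L)               ≈⟨ *-cong (eq (here refl) y∈ r)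
                                              (prodR-match ρ L (M₁ ++ M₂) fwd′ back′ pL (AllPairs.tail pM′)
                                                (λ x∈ m → eq (there x∈) (∈-resp-↭ (↭-sym (shift y M₁ M₂)) (there m)))) ⟩
    h y *ᵣ prodR (map h (M₁ ++ M₂))      ≈⟨ prodR-shift h M₁ M₂ ⟨
    prodR (map h (M₁ ++ y ∷ M₂))         ∎
    where
    -- Separation is symmetric in the pair, so it survives moving `y` to the front; its head then
    -- says that nothing else in the list shares a partner with `y`.
    pM′ : AllPairs (λ y y′ → ∀ x → ρ x y → ρ x y′ → ⊥) (y ∷ M₁ ++ M₂)
    pM′ = ↭ₛ.AllPairs-resp-↭ (≡.setoid B) (λ f z p q → f z q p) ((λ { refl z → z }) , (λ { refl z → z }))
            (↭⇒↭ₛ (shift y M₁ M₂)) pM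
    fwd′ : ∀ {x′} → x′ ∈ L → ∃ λ y′ → y′ ∈ M₁ ++ M₂ × ρ x′ y′
    fwd′ x∈ with fwd (there x∈)
    ... | y′ , m , r′ with ∈-resp-↭ (shift y M₁ M₂) m
    ...   | there m′ = y′ , m′ , r′
    ...   | here refl = ⊥-elim (All.lookup px x∈ y r r′)
    back′ : ∀ {y′} → y′ ∈ M₁ ++ M₂ → ∃ λ x′ → x′ ∈ L × ρ x′ y′
    back′ m with back (∈-resp-↭ (↭-sym (shift y M₁ M₂)) (there m))
    ... | x′ , there x∈ , r′ = x′ , x∈ , r′
    ... | _ , here refl , r′ = ⊥-elim (All.lookup (AllPairs.head pM′) m x r r′)

  -- K selects exactly one factor, in which the product is additive.
  prodR-linear : ∀ {B : Set} (K : B → Bool) {f₁ f₂ f₃ : B → Carrier} (z : Carrier) L →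
    Any (T ∘ K) L → AllPairs (λ i j → T (K i) → T (K j) → ⊥) L →
    (∀ i → ¬ T (K i) → f₁ i ≈ f₂ i × f₂ i ≈ f₃ i) →
    (∀ i → T (K i) → f₁ i ≈ f₂ i +ᵣ z *ᵣ f₃ i) →
    prodR (map f₁ L) ≈ prodR (map f₂ L) +ᵣ z *ᵣ prodR (map f₃ L)
  prodR-linear K {f₁} {f₂} {f₃} z (x ∷ L) (here k) (px ∷ pL) same lin = begin
    f₁ x *ᵣ prodR (map f₁ L)                                        ≈⟨ *-cong (lin x k) (prodR-cong L (proj₁ ∘ same _ ∘ off)) ⟩
    (f₂ x +ᵣ z *ᵣ f₃ x) *ᵣ prodR (map f₂ L)                          ≈⟨ distribʳ _ _ _ ⟩
    f₂ x *ᵣ prodR (map f₂ L) +ᵣ (z *ᵣ f₃ x) *ᵣ prodR (map f₂ L)       ≈⟨ +-congˡ (≈-trans (*-assoc _ _ _) (*-congˡ (*-congˡ (prodR-cong L (proj₂ ∘ same _ ∘ off))))) ⟩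
    f₂ x *ᵣ prodR (map f₂ L) +ᵣ z *ᵣ (f₃ x *ᵣ prodR (map f₃ L))       ∎
    where
    off : ∀ {y} → y ∈ L → ¬ T (K y)
    off m = All.lookup px m k
  prodR-linear K {f₁} {f₂} {f₃} z (x ∷ L) (there a) (px ∷ pL) same lin = begin
    f₁ x *ᵣ prodR (map f₁ L)                                        ≈⟨ *-cong (proj₁ (same x off)) (prodR-linear K z L a pL same lin) ⟩
    f₂ x *ᵣ (prodR (map f₂ L) +ᵣ z *ᵣ prodR (map f₃ L))              ≈⟨ distribˡ _ _ _ ⟩
    f₂ x *ᵣ prodR (map f₂ L) +ᵣ f₂ x *ᵣ (z *ᵣ prodR (map f₃ L))       ≈⟨ +-congˡ (≈-trans (*-congʳ (proj₂ (same x off))) (*-exchange _ _ _)) ⟩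
    f₂ x *ᵣ prodR (map f₂ L) +ᵣ z *ᵣ (f₃ x *ᵣ prodR (map f₃ L))       ∎
    where
    off : ¬ T (K x)
    off k with find a
    ... | y , y∈ , t = All.lookup px y∈ k t

  subsetSum : (List Edge → Carrier) → List Edge → Carrier
  subsetSum f E = sumR (map f (subsets E))

  subsetSum-∷ : ∀ f e E → subsetSum f (e ∷ E) ≈ subsetSum (f ∘ (e ∷_)) E +ᵣ subsetSum f E
  subsetSum-∷ f e E = ≈-trans
    (≈-reflexive (cong sumR (trans (map-++ f (map (e ∷_) (subsets E)) (subsets E))
      (cong (_++ map f (subsets E)) (sym (map-∘ (subsets E)))))))
    (sumR-++ (map (f ∘ (e ∷_)) (subsets E)) (map f (subsets E)))

  -- A property of single edges is inherited by every subset. This lets the summands be compared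
  -- under validity assumptions that hold for subsets of `E` only.
  subsetSum-cong : ∀ {q} (Q : Edge → Set q) {f g} E → All Q E → (∀ A → All Q A → f A ≈ g A) → subsetSum f E ≈ subsetSum g E
  subsetSum-cong Q [] [] h = +-congʳ (h [] [])
  subsetSum-cong Q {f} {g} (e ∷ E) (qe ∷ qE) h = begin
    subsetSum f (e ∷ E)                        ≈⟨ subsetSum-∷ f e E ⟩
    subsetSum (f ∘ (e ∷_)) E +ᵣ subsetSum f E   ≈⟨ +-cong (subsetSum-cong Q E qE λ A qA → h (e ∷ A) (qe ∷ qA)) (subsetSum-cong Q E qE h) ⟩
    subsetSum (g ∘ (e ∷_)) E +ᵣ subsetSum g E   ≈⟨ subsetSum-∷ g e E ⟨
    subsetSum g (e ∷ E)                        ∎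

  subsetSum-+ : ∀ f g E → subsetSum (λ A → f A +ᵣ g A) E ≈ subsetSum f E +ᵣ subsetSum g E
  subsetSum-+ f g [] = ≈-trans (+-identityʳ _) (≈-sym (+-cong (+-identityʳ _) (+-identityʳ _)))
  subsetSum-+ f g (e ∷ E) = begin
    subsetSum (λ A → f A +ᵣ g A) (e ∷ E)
      ≈⟨ subsetSum-∷ _ e E ⟩
    subsetSum (λ A → f (e ∷ A) +ᵣ g (e ∷ A)) E +ᵣ subsetSum (λ A → f A +ᵣ g A) E
      ≈⟨ +-cong (subsetSum-+ (f ∘ (e ∷_)) (g ∘ (e ∷_)) E) (subsetSum-+ f g E) ⟩
    (subsetSum (f ∘ (e ∷_)) E +ᵣ subsetSum (g ∘ (e ∷_)) E) +ᵣ (subsetSum f E +ᵣ subsetSum g E)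
      ≈⟨ +-interchange _ _ _ _ ⟩
    (subsetSum (f ∘ (e ∷_)) E +ᵣ subsetSum f E) +ᵣ (subsetSum (g ∘ (e ∷_)) E +ᵣ subsetSum g E)
      ≈⟨ +-cong (subsetSum-∷ f e E) (subsetSum-∷ g e E) ⟨
    subsetSum f (e ∷ E) +ᵣ subsetSum g (e ∷ E) ∎

  subsetSum-* : ∀ z f E → subsetSum (λ A → z *ᵣ f A) E ≈ z *ᵣ subsetSum f E
  subsetSum-* z f [] = ≈-trans (+-congˡ (≈-sym (zeroʳ z))) (≈-sym (distribˡ z _ _))
  subsetSum-* z f (e ∷ E) = begin
    subsetSum (λ A → z *ᵣ f A) (e ∷ E)                                ≈⟨ subsetSum-∷ _ e E ⟩
    subsetSum (λ A → z *ᵣ f (e ∷ A)) E +ᵣ subsetSum (λ A → z *ᵣ f A) E  ≈⟨ +-cong (subsetSum-* z _ E) (subsetSum-* z f E) ⟩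
    z *ᵣ subsetSum (f ∘ (e ∷_)) E +ᵣ z *ᵣ subsetSum f E                ≈⟨ distribˡ z _ _ ⟨
    z *ᵣ (subsetSum (f ∘ (e ∷_)) E +ᵣ subsetSum f E)                   ≈⟨ *-congˡ (subsetSum-∷ f e E) ⟨
    z *ᵣ subsetSum f (e ∷ E)                                          ∎

  subsetSum-map : ∀ f (r : Edge → Edge) E → subsetSum f (map r E) ≈ subsetSum (f ∘ map r) E
  subsetSum-map f r [] = ≈-refl
  subsetSum-map f r (e ∷ E) = begin
    subsetSum f (r e ∷ map r E)                                   ≈⟨ subsetSum-∷ f (r e) (map r E) ⟩
    subsetSum (f ∘ (r e ∷_)) (map r E) +ᵣ subsetSum f (map r E)    ≈⟨ +-cong (subsetSum-map _ r E) (subsetSum-map f r E) ⟩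
    subsetSum (f ∘ map r ∘ (e ∷_)) E +ᵣ subsetSum (f ∘ map r) E    ≈⟨ subsetSum-∷ (f ∘ map r) e E ⟨
    subsetSum (f ∘ map r) (e ∷ E)                                 ∎

  -- Moving `e` changes the subsets only in the order of their elements, hence the invariance of
  -- `f`. Passing `e` over one `x` exchanges the two middle sums among the four choices for `x` and
  -- `e`.
  subsetSum-shift : ∀ f E₁ e E₂ → (∀ A B → A ↭ B → f A ≈ f B) →
    subsetSum f (E₁ ++ e ∷ E₂) ≈ subsetSum f (e ∷ E₁ ++ E₂)
  subsetSum-shift f [] e E₂ perm = ≈-refl
  subsetSum-shift f (x ∷ E₁) e E₂ perm = begin
    S f (x ∷ E₁ ++ e ∷ E₂)                                                     ≈⟨ subsetSum-∷ f x (E₁ ++ e ∷ E₂) ⟩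
    S (f ∘ (x ∷_)) (E₁ ++ e ∷ E₂) +ᵣ S f (E₁ ++ e ∷ E₂)
      ≈⟨ +-cong (subsetSum-shift (f ∘ (x ∷_)) E₁ e E₂ (λ A B p → perm _ _ (prep x p))) (subsetSum-shift f E₁ e E₂ perm) ⟩
    S (f ∘ (x ∷_)) (e ∷ E) +ᵣ S f (e ∷ E)                                       ≈⟨ +-cong (subsetSum-∷ _ e E) (subsetSum-∷ f e E) ⟩
    (S (f ∘ (x ∷_) ∘ (e ∷_)) E +ᵣ S (f ∘ (x ∷_)) E) +ᵣ (S (f ∘ (e ∷_)) E +ᵣ S f E)  ≈⟨ +-interchange _ _ _ _ ⟩
    (S (f ∘ (x ∷_) ∘ (e ∷_)) E +ᵣ S (f ∘ (e ∷_)) E) +ᵣ (S (f ∘ (x ∷_)) E +ᵣ S f E)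
      ≈⟨ +-congʳ (+-congʳ (subsetSum-cong (λ _ → ⊤) E (All.universal _ E) λ A _ → perm _ _ (swap x e ↭-refl))) ⟩
    (S (f ∘ (e ∷_) ∘ (x ∷_)) E +ᵣ S (f ∘ (e ∷_)) E) +ᵣ (S (f ∘ (x ∷_)) E +ᵣ S f E)
      ≈⟨ +-cong (subsetSum-∷ (f ∘ (e ∷_)) x E) (subsetSum-∷ f x E) ⟨
    S (f ∘ (e ∷_)) (x ∷ E) +ᵣ S f (x ∷ E)                                       ≈⟨ subsetSum-∷ f e (x ∷ E) ⟨
    S f (e ∷ x ∷ E)                                                            ∎
    where
    S = subsetSum
    E = E₁ ++ E₂

  -- A subset of `E` is an independent choice of a subset on either side of `p`, so the double sum
  -- factors by distributivity.
  subsetSum-filter : ∀ f g (p : Edge → Bool) E →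
    subsetSum (λ A → f (filterᵇ p A) *ᵣ g (filterᵇ (not ∘ p) A)) E ≈
    subsetSum f (filterᵇ p E) *ᵣ subsetSum g (filterᵇ (not ∘ p) E)
  subsetSum-filter f g p [] = ≈-trans (+-identityʳ _) (≈-sym (*-cong (+-identityʳ _) (+-identityʳ _)))
  subsetSum-filter f g p (e ∷ E) = ≈-trans (subsetSum-∷ _ e E) (≈-trans (+-congˡ (subsetSum-filter f g p E)) hop)
    where
    hop : subsetSum (λ A → f (filterᵇ p (e ∷ A)) *ᵣ g (filterᵇ (not ∘ p) (e ∷ A))) E +ᵣ
             subsetSum f (filterᵇ p E) *ᵣ subsetSum g (filterᵇ (not ∘ p) E) ≈
           subsetSum f (filterᵇ p (e ∷ E)) *ᵣ subsetSum g (filterᵇ (not ∘ p) (e ∷ E))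
    hop with p e
    ... | true  = ≈-trans (+-congʳ (subsetSum-filter (f ∘ (e ∷_)) g p E))
                    (≈-trans (≈-sym (distribʳ _ _ _)) (*-congʳ (≈-sym (subsetSum-∷ f e (filterᵇ p E)))))
    ... | false = ≈-trans (+-congʳ (subsetSum-filter f (g ∘ (e ∷_)) p E))
                    (≈-trans (≈-sym (distribˡ _ _ _)) (*-congˡ (≈-sym (subsetSum-∷ g e (filterᵇ (not ∘ p) E)))))

-- The product over the blocks of one edge subset

module Blocks {c ℓ : Level} (R : CommutativeRing c ℓ) (φ : ℕ → ℕ → CommutativeRing.Carrier R) where
  open CommutativeRing R renaming (_+_ to _+ᵣ_; _*_ to _*ᵣ_; refl to ≈-refl; sym to ≈-sym; trans to ≈-trans; reflexive to ≈-reflexive)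
  open Sums R
  open WithRing R using (Mpoly)
  open SetoidReasoning setoid

  val : Mark → Carrier
  val m = φ (w m) (d m)

  blockProd : List Entry → List Edge → Carrier
  blockProd V A = prodR (map (λ r → val (compMark (graph V A) r)) (reps (graph V A)))

  -- The value at the mark of the component of `i`, expressed by additive data; `pred` recovers `d`
  -- from the total of `1+d`.
  weightAt : List Entry → List Edge → ℕ → Carrier
  weightAt V A i = φ (mass w (connᵇ V A i) V) (pred (mass 1+d (connᵇ V A i) V))

  val-compMark : ∀ {V A} → Valid V A → ∀ {r} → r ∈ V → val (compMark (graph V A) r) ≡ weightAt V A (proj₁ r)
  val-compMark va r∈ = cong₂ φ (compMark-mass w ∔-w va r∈) (cong pred (compMark-mass 1+d ∔-1+d va r∈))

  blockProd-weights : ∀ {V A} → Valid V A → blockProd V A ≈ prodR (map (weightAt V A ∘ proj₁) (reps (graph V A)))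
  blockProd-weights {V} {A} va = prodR-cong (reps (graph V A)) λ r∈ → ≈-reflexive (val-compMark va (reps-⊆ va r∈))

  weightAt-cong : ∀ V V′ A A′ i j → (∀ t → (∀ a b → t (a ∔ b) ≡ t a + t b) → mass t (connᵇ V A i) V ≡ mass t (connᵇ V′ A′ j) V′) →
    weightAt V A i ≡ weightAt V′ A′ j
  weightAt-cong V V′ A A′ i j h = cong₂ φ (h w ∔-w) (cong pred (h 1+d ∔-1+d))

  weightAt-Conn : ∀ {V A} → Valid V A → ∀ {i j} → i ∈ map proj₁ V → j ∈ map proj₁ V → Conn A i j → weightAt V A i ≡ weightAt V A j
  weightAt-Conn {V} {A} va {i} {j} i∈ j∈ c = weightAt-cong V V A A i j λ t _ → mass-cong t V λ {k} _ →
    T-ext (λ b → connᵇ⁺ va k j∈ (Conn-sym c ◅◅ connᵇ⁻ V A i k b)) (λ b → connᵇ⁺ va k i∈ (c ◅◅ connᵇ⁻ V A j k b))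

  -- Renaming maps blocks to blocks bijectively but need not map representatives to representatives.
  -- The matching relation therefore asks only that the renamed old representative be connected to
  -- the new one.
  blockProd-contract : ∀ {V A u v mu mv} → Valid V A → (u , mu) ∈ V → (v , mv) ∈ V → u ≢ v →
    blockProd V ((u , v) ∷ A) ≈ blockProd (mergeV (_∔ mv) u v V) (map (renameE u v) A)
  blockProd-contract {V} {A} {u} {v} {mu} {mv} va u∈ v∈ u≢v =
    prodR-match ρ (reps (graph V A⁺)) (reps (graph V′ A′)) fwd back
      (AllPairs.map (λ ¬c y p q → ¬c (down (p ◅◅ Conn-sym q))) (reps-pairs va⁺))
      (AllPairs.map (λ ¬c x p q → ¬c (Conn-sym p ◅◅ q)) (reps-pairs va′))
      (λ x∈ y∈ c → ≈-reflexive (trans (val-compMark va⁺ (reps-⊆ va⁺ x∈))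
        (trans (same (∈-map⁺ proj₁ (reps-⊆ va⁺ x∈)) (∈-map⁺ proj₁ (reps-⊆ va′ y∈)) c) (sym (val-compMark va′ (reps-⊆ va′ y∈))))))
    where
    A⁺ = (u , v) ∷ A
    V′ = mergeV (_∔ mv) u v V
    A′ = map (renameE u v) A
    va⁺ : Valid V A⁺
    va⁺ = mkValid (unique-ids va) ((∈-map⁺ proj₁ u∈ , ∈-map⁺ proj₁ v∈) ∷ endpoints va)
    va′ : Valid V′ A′
    va′ = Valid-merge (_∔ mv) {V = V} (∈-map⁺ proj₁ u∈) u≢v va
    ρ : Entry → Entry → Set
    ρ x y = Conn A′ (renameV u v (proj₁ x)) (proj₁ y)
    down : ∀ {x y} → Conn A′ (renameV u v x) (renameV u v y) → Conn A⁺ x y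
    down {x} {y} c = Conn-sym (conn-renamed u v A x) ◅◅ (conn-rename⁻ u v A c ◅◅ conn-renamed u v A y)
    fixed : ∀ {y} → y ∈ map proj₁ V′ → renameV u v y ≡ y
    fixed y∈ = renameV-≢ u v (proj₂ (mergeV-∈⁻ (_∔ mv) {V = V} y∈))
    fwd : ∀ {x} → x ∈ reps (graph V A⁺) → ∃ λ y → y ∈ reps (graph V′ A′) × ρ x y
    fwd x∈ = reps-cover va′ (rename-∈ (_∔ mv) {V = V} (∈-map⁺ proj₁ u∈) u≢v (∈-map⁺ proj₁ (reps-⊆ va⁺ x∈)))
    back : ∀ {y} → y ∈ reps (graph V′ A′) → ∃ λ x → x ∈ reps (graph V A⁺) × ρ x y
    back {y} y∈ with reps-cover va⁺ (proj₁ (mergeV-∈⁻ (_∔ mv) {V = V} (∈-map⁺ proj₁ (reps-⊆ va′ y∈))))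
    ... | x , x∈ , c = x , x∈ , subst (Conn A′ _) (fixed (∈-map⁺ proj₁ (reps-⊆ va′ y∈))) (Conn-sym (conn-rename⁺ u v A c))
    same : ∀ {i j} → i ∈ map proj₁ V → j ∈ map proj₁ V′ → Conn A′ (renameV u v i) j → weightAt V A⁺ i ≡ weightAt V′ A′ j
    same {i} {j} i∈ j∈ c = weightAt-cong V V′ A⁺ A′ i j λ t add → trans
      (mass-cong t V λ {k} k∈ → T-ext
        (λ b → connᵇ⁺ va′ (renameV u v k) j∈ (Conn-sym c ◅◅ conn-rename⁺ u v A (connᵇ⁻ V A⁺ i k b)))
        (λ b → connᵇ⁺ va⁺ k i∈ (down (c ◅◅ connᵇ⁻ V′ A′ j (renameV u v k) b))))
      (sym (mass-mergeV t add (connᵇ V′ A′ j) (unique-ids va) u∈ v∈ u≢v))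

  -- Saturation keeps every block on one side of `p`, and connectivity inside a side is the same
  -- with or without the other side. Connectivity in `A` then matches the representatives.
  blockProd-split : ∀ {V A} p → Valid V A → Saturated p A →
    blockProd V A ≈ blockProd (restrictV p V) (restrictE p A) *ᵣ blockProd (restrictV (not ∘ p) V) (restrictE (not ∘ p) A)
  blockProd-split {V} {A} p va sat = begin
    blockProd V A                                          ≈⟨ blockProd-weights va ⟩
    prodR (map g (reps (graph V A)))                       ≈⟨ prodR-match ρ (reps (graph V A)) (L p ++ L p′) fwd back
                                                                (AllPairs.map (λ ¬c y a b → ¬c (a ◅◅ Conn-sym b)) (reps-pairs va))
                                                                (AllPairs.++⁺ (pairs p sat) (pairs p′ sat′) (All.tabulate λ a∈ → All.tabulate λ b∈ → cross a∈ b∈))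
                                                                (λ x∈ y∈ c → ≈-reflexive (weightAt-Conn va (∈-map⁺ proj₁ (reps-⊆ va x∈))
                                                                  (Conn-endpoint (endpoints va) (∈-map⁺ proj₁ (reps-⊆ va x∈)) c) c)) ⟩
    prodR (map g (L p ++ L p′))                            ≈⟨ ≈-reflexive (cong prodR (map-++ g (L p) (L p′))) ⟩
    prodR (map g (L p) ++ map g (L p′))                    ≈⟨ prodR-++ (map g (L p)) (map g (L p′)) ⟩
    prodR (map g (L p)) *ᵣ prodR (map g (L p′))            ≈⟨ *-cong (part p sat) (part p′ sat′) ⟨
    blockProd (restrictV p V) (restrictE p A) *ᵣ blockProd (restrictV p′ V) (restrictE p′ A) ∎
    where
    p′ : ℕ → Bool
    p′ = not ∘ p
    sat′ = Saturated-not sat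
    g : Entry → Carrier
    g = weightAt V A ∘ proj₁
    ρ : Entry → Entry → Set
    ρ x y = Conn A (proj₁ x) (proj₁ y)
    L : (ℕ → Bool) → List Entry
    L q = reps (graph (restrictV q V) (restrictE q A))
    reps-id : ∀ q → Saturated q A → ∀ {r} → r ∈ L q → proj₁ r ∈ map proj₁ V × T (q (proj₁ r))
    reps-id q s r∈ = restrictV-∈⁻ q {V} (∈-map⁺ proj₁ (reps-⊆ (Valid-restrict s va) r∈))
    part : ∀ q → Saturated q A → blockProd (restrictV q V) (restrictE q A) ≈ prodR (map g (L q))
    part q s = ≈-trans (blockProd-weights (Valid-restrict s va)) (prodR-cong (L q) λ {r} r∈ →
      let (r∈V , qr) = reps-id q s r∈ in ≈-reflexive (weightAt-cong (restrictV q V) V (restrictE q A) A (proj₁ r) (proj₁ r) λ t _ →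
        trans (mass-filterᵇ t (connᵇ (restrictV q V) (restrictE q A) (proj₁ r)) q V)
          (mass-cong t V λ {k} _ → T-ext
            (λ b → connᵇ⁺ va k r∈V (Conn-unrestrict q (connᵇ⁻ (restrictV q V) (restrictE q A) (proj₁ r) k (proj₂ (∧⁻ {q k} b)))))
            (λ b → ∧⁺ (subst T (Conn-saturated s (connᵇ⁻ V A (proj₁ r) k b)) qr)
                      (connᵇ⁺ (Valid-restrict s va) k (∈-map⁺ proj₁ (reps-⊆ (Valid-restrict s va) r∈))
                        (Conn-restrict s (connᵇ⁻ V A (proj₁ r) k b) qr))))))
    pairs : ∀ q → Saturated q A → AllPairs (λ y y′ → ∀ x → ρ x y → ρ x y′ → ⊥) (L q)
    pairs q s = go (L q) id (reps-pairs (Valid-restrict s va))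
      where
      go : ∀ M → (∀ {r} → r ∈ M → r ∈ L q) → AllPairs (λ r r′ → ¬ Conn (restrictE q A) (proj₁ r) (proj₁ r′)) M →
           AllPairs (λ y y′ → ∀ x → ρ x y → ρ x y′ → ⊥) M
      go [] sub [] = []
      go (y ∷ M) sub (py ∷ pM) =
        All.map (λ ¬c x a b → ¬c (Conn-restrict s (Conn-sym a ◅◅ b) (proj₂ (reps-id q s (sub (here refl)))))) py ∷ go M (sub ∘ there) pM
    cross : ∀ {a b} → a ∈ L p → b ∈ L p′ → ∀ x → ρ x a → ρ x b → ⊥
    cross a∈ b∈ x c c′ = T-not⁻ (proj₂ (reps-id p′ sat′ b∈))
      (subst T (Conn-saturated sat (Conn-sym c ◅◅ c′)) (proj₂ (reps-id p sat a∈)))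
    rep-in : ∀ q → Saturated q A → ∀ {i} → i ∈ map proj₁ V → T (q i) → ∃ λ r → r ∈ L q × Conn A i (proj₁ r)
    rep-in q s i∈ qi with reps-cover (Valid-restrict s va) (restrictV-∈⁺ q {V} i∈ qi)
    ... | r , r∈ , c = r , r∈ , Conn-unrestrict q c
    fwd : ∀ {x} → x ∈ reps (graph V A) → ∃ λ y → y ∈ L p ++ L p′ × ρ x y
    fwd {x} x∈ with T? (p (proj₁ x))
    ... | yes t = let (r , r∈ , c) = rep-in p sat (∈-map⁺ proj₁ (reps-⊆ va x∈)) t in r , ∈-++⁺ˡ r∈ , c
    ... | no ¬t = let (r , r∈ , c) = rep-in p′ sat′ (∈-map⁺ proj₁ (reps-⊆ va x∈)) (T-not⁺ ¬t) in r , ∈-++⁺ʳ (L p) r∈ , c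
    back : ∀ {y} → y ∈ L p ++ L p′ → ∃ λ x → x ∈ reps (graph V A) × ρ x y
    back {y} y∈ = let (x , x∈ , c) = reps-cover va y∈V in x , x∈ , Conn-sym c
      where
      y∈V : proj₁ y ∈ map proj₁ V
      y∈V with ∈-++⁻ (L p) y∈
      ... | inj₁ m = proj₁ (reps-id p sat m)
      ... | inj₂ m = proj₁ (reps-id p′ sat′ m)

  -- `m₃` is the mark of `u` with the leaf cut off, `m₂` the dot-sum with the leaf, `m₁` the
  -- absorbed mark. The three products run over the same representatives and differ only in the
  -- factor of the block of `u`, in which they are linear.
  blockProd-absorb : ∀ z → (∀ a b → φ (suc a) b ≈ φ (suc a) (suc b) +ᵣ z *ᵣ φ a b) →
    ∀ U₁ U₂ u {m₁ m₂ m₃ A} → Valid (U₁ ++ (u , m₃) ∷ U₂) A →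
    w m₁ ≡ suc (w m₃) → d m₁ ≡ d m₃ → w m₂ ≡ suc (w m₃) → d m₂ ≡ suc (d m₃) →
    blockProd (U₁ ++ (u , m₁) ∷ U₂) A ≈ blockProd (U₁ ++ (u , m₂) ∷ U₂) A +ᵣ z *ᵣ blockProd (U₁ ++ (u , m₃) ∷ U₂) A
  blockProd-absorb z rec U₁ U₂ u {m₁} {m₂} {m₃} {A} va w₁ d₁ w₂ d₂ = begin
    blockProd (V m₁) A                                        ≈⟨ factors m₁ ⟩
    prodR (map (f m₁) L)                                      ≈⟨ prodR-linear K z L hit once same lin ⟩
    prodR (map (f m₂) L) +ᵣ z *ᵣ prodR (map (f m₃) L)         ≈⟨ +-cong (factors m₂) (*-congˡ (factors m₃)) ⟨
    blockProd (V m₂) A +ᵣ z *ᵣ blockProd (V m₃) A             ∎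
    where
    V : Mark → List Entry
    V m = U₁ ++ (u , m) ∷ U₂
    L = map proj₁ (reps (graph (V m₃) A))
    K : ℕ → Bool
    K i = connᵇ (V m₃) A i u
    rest : (Mark → ℕ) → ℕ → ℕ
    rest t i = mass t (connᵇ (V m₃) A i) (U₁ ++ U₂)
    f : Mark → ℕ → Carrier
    f m i = φ ((if K i then w m else 0) + rest w i) (pred ((if K i then 1+d m else 0) + rest 1+d i))
    ids-V : ∀ m → map proj₁ (V m) ≡ map proj₁ (V m₃)
    ids-V m = trans (map-++ proj₁ U₁ _) (sym (map-++ proj₁ U₁ _))
    va-V : ∀ m → Valid (V m) A
    va-V m = mkValid (subst Unique (sym (ids-V m)) (unique-ids va)) (subst (λ is → Endpoints is A) (sym (ids-V m)) (endpoints va))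
    weight : ∀ m i → weightAt (V m) A i ≡ f m i
    weight m i = cong₂ (λ a b → φ a (pred b)) (at w) (at 1+d)
      where
      at : ∀ t → mass t (connᵇ (V m) A i) (V m) ≡ (if K i then t m else 0) + rest t i
      at t = trans (mass-cong t (V m) λ {j} _ → connᵇ-cong {V m} {V m₃} A i j (ids-V m)) (mass-zipper t _ U₁ U₂)
    factors : ∀ m → blockProd (V m) A ≈ prodR (map (f m) L)
    factors m = ≈-trans (blockProd-weights (va-V m)) (≈-reflexive (cong prodR
      (trans (map-∘ (reps (graph (V m) A))) (trans (cong (map (weightAt (V m) A)) (ids-reps-cong {V m} {V m₃} A (ids-V m))) (map-cong (weight m) L)))))
    hit : Any (T ∘ K) L
    hit with reps-cover va (∈-map⁺ proj₁ (∈-insert U₁))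
    ... | r , r∈ , c = lose (∈-map⁺ proj₁ r∈) (connᵇ⁺ va u (∈-map⁺ proj₁ (reps-⊆ va r∈)) (Conn-sym c))
    once : AllPairs (λ i j → T (K i) → T (K j) → ⊥) L
    once = AllPairs.map⁺ (AllPairs.map (λ ¬c a b → ¬c (connᵇ⁻ (V m₃) A _ u a ◅◅ Conn-sym (connᵇ⁻ (V m₃) A _ u b))) (reps-pairs va))
    same : ∀ i → ¬ T (K i) → f m₁ i ≈ f m₂ i × f m₂ i ≈ f m₃ i
    same i ¬k with K i
    ... | true  = ⊥-elim (¬k _)
    ... | false = ≈-refl , ≈-refl
    lin : ∀ i → T (K i) → f m₁ i ≈ f m₂ i +ᵣ z *ᵣ f m₃ i
    lin i k with K i
    -- The arguments are the total weight and the total `d` of the block when `u` carries `m₃`; the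
    -- other vertices enter the latter through `1+d`.
    ... | true rewrite w₁ | d₁ | w₂ | d₂ = rec (w m₃ + rest w i) (d m₃ + rest 1+d i)

-- Forests

Inc : ℕ → Edge → Set
Inc x e = proj₁ e ≡ x ⊎ proj₂ e ≡ x

Simple : List Edge → Set
Simple = AllPairs (λ e f → ¬ SameEdge e f)

eqE⁺ : ∀ e → T (eqE e e)
eqE⁺ (a , b) = ∧⁺ (≡ᵇ-refl a) (≡ᵇ-refl b)

eqE⁻ : ∀ e f → T (eqE e f) → e ≡ f
eqE⁻ (a , b) (c , e) t = cong₂ _,_ (≡ᵇ⇒≡ a c (proj₁ (∧⁻ t))) (≡ᵇ⇒≡ b e (proj₂ (∧⁻ {a ≡ᵇ c} t)))

eitherWay⁺ : ∀ {u v e} → SameEdge e (u , v) → T (eitherWay u v e)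
eitherWay⁺ {u} {v} (inj₁ (refl , refl)) = ∨⁺ (inj₁ (eqE⁺ (u , v)))
eitherWay⁺ {u} {v} (inj₂ (refl , refl)) = ∨⁺ {eqE (v , u) (u , v)} (inj₂ (eqE⁺ (v , u)))

eitherWay⁻ : ∀ {u v e} → T (eitherWay u v e) → SameEdge e (u , v)
eitherWay⁻ {u} {v} {e} t with ∨⁻ t
... | inj₁ k with refl ← eqE⁻ e (u , v) k = inj₁ (refl , refl)
... | inj₂ k with refl ← eqE⁻ e (v , u) k = inj₂ (refl , refl)

SameEdge-sym : ∀ {e f} → SameEdge e f → SameEdge f e
SameEdge-sym (inj₁ (refl , refl)) = inj₁ (refl , refl)
SameEdge-sym (inj₂ (refl , refl)) = inj₂ (refl , refl)

SameEdge-trans : ∀ {e f g} → SameEdge e f → SameEdge f g → SameEdge e g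
SameEdge-trans (inj₁ (refl , refl)) s = s
SameEdge-trans (inj₂ (refl , refl)) (inj₁ (refl , refl)) = inj₂ (refl , refl)
SameEdge-trans (inj₂ (refl , refl)) (inj₂ (refl , refl)) = inj₁ (refl , refl)

same⇒≡ : ∀ {E e f} → Simple E → e ∈ E → f ∈ E → SameEdge e f → e ≡ f
same⇒≡ (p ∷ ps) (here refl) (here refl) s = refl
same⇒≡ (p ∷ ps) (here refl) (there m) s = ⊥-elim (All.lookup p m s)
same⇒≡ (p ∷ ps) (there m) (here refl) s = ⊥-elim (All.lookup p m (SameEdge-sym s))
same⇒≡ (p ∷ ps) (there m) (there n) s = same⇒≡ ps m n s

dropE-∈⁻ : ∀ u v E {e} → e ∈ dropE u v E → e ∈ E × ¬ SameEdge e (u , v)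
dropE-∈⁻ u v E m with ∈-filterᵇ⁻ (λ e → not (eitherWay u v e)) {xs = E} m
... | e∈ , t = e∈ , T-not⁻ t ∘ eitherWay⁺

dropE-∈⁺ : ∀ u v {E e} → e ∈ E → ¬ SameEdge e (u , v) → e ∈ dropE u v E
dropE-∈⁺ u v e∈ ¬s = ∈-filterᵇ⁺ (λ e → not (eitherWay u v e)) e∈ (T-not⁺ (¬s ∘ eitherWay⁻))

dropE-split : ∀ {u v E e} → Simple E → e ∈ E → SameEdge e (u , v) →
  ∃ λ E₁ → ∃ λ E₂ → E ≡ E₁ ++ e ∷ E₂ × dropE u v E ≡ E₁ ++ E₂
dropE-split {u} {v} {e ∷ E} (p ∷ ps) (here refl) s = [] , E , refl ,
  trans (filter-reject (T? ∘ λ f → not (eitherWay u v f)) {e} {E} (λ t → T-not⁻ t (eitherWay⁺ s)))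
    (filterᵇ-all _ E λ f∈ → T-not⁺ λ t → All.lookup p f∈ (SameEdge-trans s (SameEdge-sym (eitherWay⁻ t))))
dropE-split {u} {v} {f ∷ E} (p ∷ ps) (there m) s with dropE-split ps m s
... | E₁ , E₂ , eq , eq′ = f ∷ E₁ , E₂ , cong (f ∷_) eq ,
  trans (filter-accept (T? ∘ λ f → not (eitherWay u v f)) {f} {E} (T-not⁺ λ t → All.lookup p m (SameEdge-trans (eitherWay⁻ t) (SameEdge-sym s))))
    (cong (f ∷_) eq′)

-- How acyclicity passes to minors: a cycle in the minor is sent injectively back into the graph it
-- came from.
Cycle-map : ∀ {G H} (σ : ℕ → ℕ) → (∀ {x y} → σ x ≡ σ y → x ≡ y) →
  (∀ {x y} → Adj G x y → Adj H (σ x) (σ y)) → ∀ xs → Cycle G xs → Cycle H (map σ xs)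
Cycle-map σ inj adj (x ∷ xs) (two , uniq , link) =
  subst (2 ≤_) (sym (length-map σ xs)) two ,
  Unique.map⁺ inj uniq ,
  subst (Linked _) (map-++ σ (x ∷ xs) (x ∷ [])) (Linked.map⁺ (Linked.map adj link))

forest-valid : ∀ {G} → IsMarkedForest G → Valid (verts G) (edges G)
forest-valid (_ , us , es , _) = mkValid us (All.map (λ { (a , b , _) → a , b }) es)

forest-simple : ∀ {G} → IsMarkedForest G → Simple (edges G)
forest-simple (_ , _ , _ , s , _) = s

forest-loopless : ∀ {G x y} → IsMarkedForest G → Nbr (edges G) x y → x ≢ y
forest-loopless (_ , _ , es , _) (inj₁ m) = proj₂ (proj₂ (All.lookup es m))
forest-loopless (_ , _ , es , _) (inj₂ m) e = proj₂ (proj₂ (All.lookup es m)) (sym e)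

nonempty : ∀ {a} {A : Set a} {x : A} {xs} → x ∈ xs → xs ≢ []
nonempty (here _) ()
nonempty (there _) ()

ids-nonempty : ∀ {V : List Entry} {i} → i ∈ map proj₁ V → V ≢ []
ids-nonempty {[]} ()
ids-nonempty {_ ∷ _} _ ()

forest-filter : ∀ {V E} p → IsMarkedForest (graph V E) → IsMarkedForest (graph V (filterᵇ p E))
forest-filter {V} {E} p (ne , us , es , simp , acyc) =
  ne , us , All.filter⁺ (T? ∘ p) es , AllPairs.filter⁺ (T? ∘ p) simp ,
  λ xs c → acyc _ (Cycle-map {H = graph V E} id id (Sum.map sub sub) xs c)
  where
  sub : ∀ {e} → e ∈ filterᵇ p E → e ∈ E
  sub = proj₁ ∘ ∈-filterᵇ⁻ p

forest-restrict : ∀ {V E} p {i} → IsMarkedForest (graph V E) → Saturated p E → i ∈ map proj₁ V → T (p i) →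
  IsMarkedForest (graph (restrictV p V) (restrictE p E))
forest-restrict {V} {E} p {i} fo sat i∈ pi with forest-filter (p ∘ proj₁) fo | Valid-restrict sat (forest-valid fo)
... | _ , _ , es , simp , acyc | va =
  ids-nonempty (restrictV-∈⁺ p {V} i∈ pi) , unique-ids va ,
  All.zipWith (λ { ((a , b) , (_ , _ , ne)) → a , b , ne }) (endpoints va , es) , simp ,
  λ xs c → acyc _ (Cycle-map {H = graph V (restrictE p E)} id id id xs c)

-- Undoes the renaming when `u` is the endpoint lying on no other edge. Sending `u` to `v` alone
-- would not be injective, as `Cycle-map` demands; exchanging the two is.
transpose : ℕ → ℕ → ℕ → ℕ
transpose u v x with x ≟ u | x ≟ v
... | yes _ | _     = v
... | no  _ | yes _ = u
... | no  _ | no  _ = x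

transpose-u : ∀ u v → transpose u v u ≡ v
transpose-u u v with u ≟ u
... | yes _ = refl
... | no ne = ⊥-elim (ne refl)

transpose-v : ∀ u v → transpose u v v ≡ u
transpose-v u v with v ≟ u | v ≟ v
... | yes e | _     = e
... | no  _ | yes _ = refl
... | no  _ | no ne = ⊥-elim (ne refl)

transpose-other : ∀ u v {x} → x ≢ u → x ≢ v → transpose u v x ≡ x
transpose-other u v {x} a b with x ≟ u | x ≟ v
... | yes e | _     = ⊥-elim (a e)
... | no  _ | yes e = ⊥-elim (b e)
... | no  _ | no  _ = refl

transpose-invol : ∀ u v x → transpose u v (transpose u v x) ≡ x
transpose-invol u v x with x ≟ u | x ≟ v
... | yes e | _     = trans (transpose-v u v) (sym e)
... | no  _ | yes e = trans (transpose-u u v) (sym e)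
... | no  a | no  b = transpose-other u v a b

Avoids : ℕ → List Edge → Set
Avoids x E = ∀ {f} → f ∈ E → ¬ Inc x f

-- A left inverse of the renaming on the surviving edges; it exists because
-- one of the two merged vertices lies on no other edge.
unrename : ∀ u v {D} → Avoids u D ⊎ Avoids v D → ∃ λ σ → (∀ {x y} → σ x ≡ σ y → x ≡ y) ×
  (∀ {e x} → e ∈ D → Inc x e → σ (renameV u v x) ≡ x)
unrename u v (inj₂ av) = id , id , λ e∈ inc → renameV-≢ u v λ { refl → av e∈ inc }
unrename u v (inj₁ av) = transpose u v ,
  (λ {x} {y} e → trans (sym (transpose-invol u v x)) (trans (cong (transpose u v) e) (transpose-invol u v y))) ,
  inverse
  where
  inverse : ∀ {e x} → e ∈ _ → Inc x e → transpose u v (renameV u v x) ≡ x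
  inverse {e} {x} e∈ inc with x ≟ v
  ... | yes refl = trans (cong (transpose u v) (renameV-≡ u v)) (transpose-u u v)
  ... | no ne = trans (cong (transpose u v) (renameV-≢ u v ne)) (transpose-other u v (λ { refl → av e∈ inc }) ne)

renameE-injective : ∀ u v {D e f} → Avoids u D ⊎ Avoids v D → e ∈ D → f ∈ D → renameE u v e ≡ renameE u v f → e ≡ f
renameE-injective u v {D} {a , b} {c , d} av e∈ f∈ eq with unrename u v av
... | σ , _ , inv = cong₂ _,_
  (trans (sym (inv e∈ (inj₁ refl))) (trans (cong (σ ∘ proj₁) eq) (inv f∈ (inj₁ refl))))
  (trans (sym (inv e∈ (inj₂ refl))) (trans (cong (σ ∘ proj₂) eq) (inv f∈ (inj₂ refl))))

-- With one end of `uv` on no other edge, the edges left after contraction are, up to identifiers,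
-- those left after deletion. Looplessness, simplicity and acyclicity are all pulled back along `σ`.
forest-merge : ∀ g {u v V E} → IsMarkedForest (graph V E) → Nbr E u v →
  Avoids u (dropE u v E) ⊎ Avoids v (dropE u v E) →
  IsMarkedForest (graph (mergeV g u v V) (map (renameE u v) (dropE u v E)))
forest-merge g {u} {v} {V} {E} fo nb av with forest-filter (λ e → not (eitherWay u v e)) fo | unrename u v av
... | fo′@(_ , _ , es , simp , acyc) | σ , inj , inv =
  ids-nonempty (mergeV-∈⁺ g {V = V} u∈ u≢v) , unique-ids va ,
  All.zipWith (λ { ((a , b) , ne) → a , b , ne }) (endpoints va , loopless) ,
  pairs (dropE u v E) id simp ,
  λ xs c → acyc _ (Cycle-map {H = graph V (dropE u v E)} σ inj (Sum.map back back) xs c)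
  where
  u≢v = forest-loopless {graph V E} fo nb
  u∈ = Nbr-endpoint (endpoints (forest-valid fo)) (Nbr-sym {E} nb)
  va = Valid-merge g {V = V} u∈ u≢v (forest-valid fo′)
  back : ∀ {x y} → (x , y) ∈ map (renameE u v) (dropE u v E) → (σ x , σ y) ∈ dropE u v E
  back m with ∈-map⁻ (renameE u v) m
  ... | (a , b) , ab∈ , refl = subst (_∈ dropE u v E) (sym (cong₂ _,_ (inv ab∈ (inj₁ refl)) (inv ab∈ (inj₂ refl)))) ab∈
  cancel : ∀ {e f x y} → e ∈ dropE u v E → f ∈ dropE u v E → Inc x e → Inc y f → renameV u v x ≡ renameV u v y → x ≡ y
  cancel e∈ f∈ i j eq = trans (sym (inv e∈ i)) (trans (cong σ eq) (inv f∈ j))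
  loopless : All (λ e → proj₁ e ≢ proj₂ e) (map (renameE u v) (dropE u v E))
  loopless = All.map⁺ (All.tabulate λ m eq → proj₂ (proj₂ (All.lookup es m)) (cancel m m (inj₁ refl) (inj₂ refl) eq))
  pairs : ∀ D → (∀ {e} → e ∈ D → e ∈ dropE u v E) → Simple D → Simple (map (renameE u v) D)
  pairs [] sub [] = []
  pairs (e ∷ D) sub (p ∷ ps) = All.map⁺ (All.tabulate λ m s → All.lookup p m (unsame (sub (here refl)) (sub (there m)) s)) ∷ pairs D (sub ∘ there) ps
    where
    unsame : ∀ {e f} → e ∈ dropE u v E → f ∈ dropE u v E → SameEdge (renameE u v e) (renameE u v f) → SameEdge e f
    unsame e∈ f∈ (inj₁ (p , q)) = inj₁ (cancel e∈ f∈ (inj₁ refl) (inj₁ refl) p , cancel e∈ f∈ (inj₂ refl) (inj₂ refl) q)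
    unsame e∈ f∈ (inj₂ (p , q)) = inj₂ (cancel e∈ f∈ (inj₁ refl) (inj₂ refl) p , cancel e∈ f∈ (inj₂ refl) (inj₁ refl) q)

-- Pendant edges and their minors

Leaf : List Edge → ℕ → Edge → Set
Leaf E x e = Inc x e × (∀ {f} → f ∈ E → Inc x f → f ≡ e)

Pendant : List Edge → Edge → Set
Pendant E e = e ∈ E × ∃ λ x → Leaf E x e

-- Lists only edges still to be processed. A deletion may create further pendant edges, so `P`
-- cannot be recomputed from the minor; but its own members stay pendant and distinct.
record PendantList (E P : List Edge) : Set where
  constructor mkPendantList
  field
    all-pendant : All (Pendant E) P
    distinct    : Unique P

leaf-avoids : ∀ {u v E x} → Leaf E x (u , v) → Avoids x (dropE u v E)
leaf-avoids {u} {v} {E} (_ , only) m inc with dropE-∈⁻ u v E m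
... | f∈ , ¬s with refl ← only f∈ inc = ¬s (inj₁ (refl , refl))

pendant-avoids : ∀ {u v E} → Pendant E (u , v) → Avoids u (dropE u v E) ⊎ Avoids v (dropE u v E)
pendant-avoids (_ , _ , le@(inj₁ refl , _)) = inj₁ (leaf-avoids le)
pendant-avoids (_ , _ , le@(inj₂ refl , _)) = inj₂ (leaf-avoids le)

lookup-mark : ∀ {V : List Entry} {i} → i ∈ map proj₁ V → ∃ λ m → (i , m) ∈ V
lookup-mark i∈ with ∈-map⁻ proj₁ i∈
... | (_ , m) , m∈ , refl = m , m∈

contract1-≡ : ∀ {u v V E} → IsMarkedForest (graph V E) → (u , v) ∈ E → ∃ λ mv → (v , mv) ∈ V ×
  contract1 (u , v) (graph V E) ≡ graph (mergeV (_∔ mv) u v V) (map (renameE u v) (dropE u v E))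
contract1-≡ {u} {v} fo e∈ with lookup-mark (proj₂ (All.lookup (endpoints (forest-valid fo)) e∈))
... | mv , v∈ = mv , v∈ , mergeWith-≡ _∔_ u v (unique-ids (forest-valid fo)) v∈

forest-contract : ∀ {e G} → IsMarkedForest G → Pendant (edges G) e → IsMarkedForest (contract1 e G)
forest-contract {u , v} {graph V E} fo pe with contract1-≡ fo (proj₁ pe)
... | mv , _ , eq = subst IsMarkedForest (sym eq) (forest-merge (_∔ mv) fo (inj₁ (proj₁ pe)) (pendant-avoids pe))

forest-delete : ∀ A {G} → IsMarkedForest G → IsMarkedForest (deleteAll A G)
forest-delete A fo = forest-filter _ fo

anyE⁻ : ∀ e A → T (any (eqE e) A) → e ∈ A
anyE⁻ e A t with find (any⁻ (eqE e) A t)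
... | f , f∈ , k with refl ← eqE⁻ e f k = f∈

anyE⁺ : ∀ {e A} → e ∈ A → T (any (eqE e) A)
anyE⁺ {e} e∈ = any⁺ (eqE e) (lose e∈ (eqE⁺ e))

delete-∈⁺ : ∀ A {G e} → e ∈ edges G → e ∉ A → e ∈ edges (deleteAll A G)
delete-∈⁺ A {G} {e} e∈ e∉ = ∈-filterᵇ⁺ (λ e → not (any (eqE e) A)) e∈ (T-not⁺ λ t → e∉ (anyE⁻ e A t))

-- `contractDelete` deletes first, so a contraction can be peeled off only after being moved past
-- the deletions. The renamed list deletes no additional edge because the renaming is injective on
-- the edges that survive the contraction.
contract-delete : ∀ {u v G} A → IsMarkedForest G → Pendant (edges G) (u , v) → All (_∈ edges G) A → (u , v) ∉ A →
  contract1 (u , v) (deleteAll A G) ≡ deleteAll (map (renameE u v) A) (contract1 (u , v) G)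
contract-delete {u} {v} {graph V E} A fo pe@(e∈ , _) A⊆ e∉ with contract1-≡ fo e∈ | contract1-≡ (forest-delete A {graph V E} fo) (delete-∈⁺ A {graph V E} e∈ e∉)
... | mv , v∈ , eq | mv′ , v∈′ , eq′ with refl ← mark-unique (unique-ids (forest-valid fo)) v∈ v∈′ =
  trans eq′ (trans (cong (graph (mergeV (_∔ mv) u v V)) edges-≡) (sym (cong (deleteAll (map (renameE u v) A)) eq)))
  where
  keep : Edge → Bool
  keep f = not (any (eqE f) A)
  keep′ : Edge → Bool
  keep′ f = not (any (eqE f) (map (renameE u v) A))
  survives : ∀ {f} → f ∈ A → f ∈ dropE u v E
  survives f∈ = dropE-∈⁺ u v (All.lookup A⊆ f∈) λ s → e∉ (subst (_∈ A) (same⇒≡ (forest-simple fo) (All.lookup A⊆ f∈) e∈ s) f∈)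
  agree : ∀ {f} → f ∈ dropE u v E → keep f ≡ keep′ (renameE u v f)
  agree {f} f∈ = cong not (T-ext (λ t → anyE⁺ (∈-map⁺ (renameE u v) (anyE⁻ f A t))) λ t → anyE⁺ (undo (anyE⁻ _ (map (renameE u v) A) t)))
    where
    undo : renameE u v f ∈ map (renameE u v) A → f ∈ A
    undo m with ∈-map⁻ (renameE u v) m
    ... | g , g∈ , q = subst (_∈ A) (sym (renameE-injective u v (pendant-avoids pe) f∈ (survives g∈) q)) g∈
  edges-≡ : map (renameE u v) (dropE u v (filterᵇ keep E)) ≡ filterᵇ keep′ (map (renameE u v) (dropE u v E))
  edges-≡ = trans (cong (map (renameE u v))
      (trans (filterᵇ-filterᵇ _ keep E) (trans (filterᵇ-cong E λ {f} _ → ∧-comm (keep f) _)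
        (trans (sym (filterᵇ-filterᵇ keep (λ e → not (eitherWay u v e)) E)) (filterᵇ-cong (dropE u v E) agree)))))
    (sym (filterᵇ-map keep′ (renameE u v) (dropE u v E)))

-- Names can be updated on the whole list in advance instead of edge by edge, which turns the
-- accumulator into a recursion on the list.
contractAcc-map : ∀ τ ρ A G → contractAcc (τ ∘ ρ) A G ≡ contractAcc τ (map (λ e → ρ (proj₁ e) , ρ (proj₂ e)) A) G
contractAcc-map τ ρ [] G = refl
contractAcc-map τ ρ ((u , v) ∷ A) G = contractAcc-map (renameV (τ (ρ u)) (τ (ρ v)) ∘ τ) ρ A _

contractAll-∷ : ∀ u v A G → contractAll ((u , v) ∷ A) G ≡ contractAll (map (renameE u v) A) (contract1 (u , v) G)
contractAll-∷ u v A G = contractAcc-map id (renameV u v) A (contract1 (u , v) G)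

deleteAll-∷ : ∀ e A G → deleteAll (e ∷ A) G ≡ deleteAll A (deleteAll (e ∷ []) G)
deleteAll-∷ e A (graph V E) = cong (graph V) (sym (trans (filterᵇ-filterᵇ _ _ E) (filterᵇ-cong E λ {f} _ → deMorgan (eqE f e) (any (eqE f) A))))
  where
  deMorgan : ∀ a b → not (a ∨ false) ∧ not b ≡ not (a ∨ b)
  deMorgan true  b = refl
  deMorgan false b = refl

deleteAll-[] : ∀ G → deleteAll [] G ≡ G
deleteAll-[] (graph V E) = cong (graph V) (filterᵇ-all _ E λ _ → _)

splits-map : ∀ {A : Set} (f : A → A) P → splits (map f P) ≡ map (λ s → map f (proj₁ s) , map f (proj₂ s)) (splits P)
splits-map f [] = refl
splits-map f (x ∷ P) rewrite splits-map f P = trans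
  (cong₂ _++_ (trans (sym (map-∘ (splits P))) (map-∘ (splits P))) (trans (sym (map-∘ (splits P))) (map-∘ (splits P))))
  (sym (map-++ _ (map (λ p → x ∷ proj₁ p , proj₂ p) (splits P)) _))

splits-⊆ : ∀ {A : Set} (P : List A) {s x} → s ∈ splits P → x ∈ proj₂ s → x ∈ P
splits-⊆ [] (here refl) x∈ = x∈
splits-⊆ (y ∷ P) s∈ x∈ with ∈-++⁻ (map (λ p → y ∷ proj₁ p , proj₂ p) (splits P)) s∈
... | inj₁ m with ∈-map⁻ (λ p → y ∷ proj₁ p , proj₂ p) m
...   | s , s∈′ , refl = there (splits-⊆ P s∈′ x∈)
splits-⊆ (y ∷ P) s∈ x∈ | inj₂ m with ∈-map⁻ (λ p → proj₁ p , y ∷ proj₂ p) m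
splits-⊆ (y ∷ P) s∈ (here refl) | inj₂ m | s , s∈′ , refl = here refl
splits-⊆ (y ∷ P) s∈ (there x∈) | inj₂ m | s , s∈′ , refl = there (splits-⊆ P s∈′ x∈)

minors : List Edge → MGraph → List MGraph
minors P G = map (λ s → contractDelete s G) (splits P)

-- Reduces the simultaneous treatment of all pendant edges to one deletion and contraction: the
-- splits are sorted by the side on which the first edge falls.
minors-∷ : ∀ {u v P G} → IsMarkedForest G → PendantList (edges G) ((u , v) ∷ P) →
  minors ((u , v) ∷ P) G ≡ minors (map (renameE u v) P) (contract1 (u , v) G) ++ minors P (deleteAll ((u , v) ∷ []) G)
minors-∷ {u} {v} {P} {G} fo (mkPendantList (pe ∷ ps) (d ∷ ds)) = trans (map-++ _ (map (λ p → e ∷ proj₁ p , proj₂ p) (splits P)) _)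
  (cong₂ _++_ contracted deleted)
  where
  e = (u , v)
  contracted : map (λ s → contractDelete s G) (map (λ p → e ∷ proj₁ p , proj₂ p) (splits P)) ≡ minors (map (renameE u v) P) (contract1 e G)
  contracted = trans (sym (map-∘ (splits P))) (trans
    (map-cong-∈ (splits P) λ { {A₁ , A₂} s∈ → trans (contractAll-∷ u v A₁ (deleteAll A₂ G))
      (cong (contractAll (map (renameE u v) A₁)) (contract-delete A₂ fo pe
        (All.tabulate λ f∈ → proj₁ (All.lookup ps (splits-⊆ P s∈ f∈))) (λ e∈ → All.lookup d (splits-⊆ P s∈ e∈) refl))) })
    (trans (map-∘ (splits P)) (cong (map (λ s → contractDelete s (contract1 e G))) (sym (splits-map (renameE u v) P)))))
  deleted : map (λ s → contractDelete s G) (map (λ p → proj₁ p , e ∷ proj₂ p) (splits P)) ≡ minors P (deleteAll (e ∷ []) G)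
  deleted = trans (sym (map-∘ (splits P))) (map-cong (λ { (A₁ , A₂) → cong (contractAll A₁) (deleteAll-∷ e A₂ G) }) (splits P))

pendant-delete : ∀ {e P G} → PendantList (edges G) (e ∷ P) → PendantList (edges (deleteAll (e ∷ []) G)) P
pendant-delete {e} {P} {G} (mkPendantList (pe ∷ ps) (d ∷ ds)) = mkPendantList
  (All.zipWith (λ { (e≢f , f∈ , x , inc , only) → delete-∈⁺ (e ∷ []) {G} f∈ (λ { (here q) → e≢f (sym q) }) ,
    x , inc , λ {g} g∈ → only (proj₁ (∈-filterᵇ⁻ (λ e′ → not (any (eqE e′) (e ∷ []))) g∈)) }) (d , ps)) ds

-- The leaf end `x` of another listed edge `f` is neither `u` nor `v`, since `(u , v)` would then be
-- an edge at `x` different from `f`. Hence `x` keeps its name and its only edge.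
pendant-contract : ∀ {u v P G} → IsMarkedForest G → PendantList (edges G) ((u , v) ∷ P) →
  PendantList (edges (contract1 (u , v) G)) (map (renameE u v) P)
pendant-contract {u} {v} {P} {G} fo (mkPendantList (pe ∷ ps) (d ∷ ds)) with contract1-≡ fo (proj₁ pe)
... | mv , _ , eq = subst (λ E → PendantList E (map (renameE u v) P)) (sym (cong edges eq))
  (mkPendantList (All.map⁺ (All.zipWith pend′ (d , ps))) (uniq P (λ m → survives (All.lookup d m) (proj₁ (All.lookup ps m))) ds))
  where
  E = edges G
  survives : ∀ {f} → (u , v) ≢ f → f ∈ E → f ∈ dropE u v E
  survives ne f∈ = dropE-∈⁺ u v f∈ λ s → ne (sym (same⇒≡ (forest-simple fo) f∈ (proj₁ pe) s))
  pend′ : ∀ {f} → ((u , v) ≢ f) × Pendant E f → Pendant (map (renameE u v) (dropE u v E)) (renameE u v f)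
  pend′ {f} (ne , f∈ , x , inc , only) = ∈-map⁺ (renameE u v) (survives ne f∈) , x , Sum.map (fix x≢v) (fix x≢v) inc , only′
    where
    x≢u : x ≢ u
    x≢u refl = ne (only (proj₁ pe) (inj₁ refl))
    x≢v : x ≢ v
    x≢v refl = ne (only (proj₁ pe) (inj₂ refl))
    fix : ∀ {a} → x ≢ v → a ≡ x → renameV u v a ≡ x
    fix ne refl = renameV-≢ u v ne
    unfix : ∀ {a} → renameV u v a ≡ x → a ≡ x
    unfix {a} q with a ≟ v
    ... | yes refl = ⊥-elim (x≢u (trans (sym q) (renameV-≡ u v)))
    ... | no a≢v = trans (sym (renameV-≢ u v a≢v)) q
    only′ : ∀ {g} → g ∈ map (renameE u v) (dropE u v E) → Inc x g → g ≡ renameE u v f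
    only′ g∈ i with ∈-map⁻ (renameE u v) g∈
    ... | h , h∈ , refl = cong (renameE u v) (only (proj₁ (dropE-∈⁻ u v E h∈)) (Sum.map unfix unfix i))
  uniq : ∀ Q → (∀ {f} → f ∈ Q → f ∈ dropE u v E) → Unique Q → Unique (map (renameE u v) Q)
  uniq [] sub [] = []
  uniq (f ∷ Q) sub (q ∷ qs) = All.map⁺ (All.tabulate λ m r → All.lookup q m
    (renameE-injective u v (pendant-avoids pe) (sub (here refl)) (sub (there m)) r)) ∷ uniq Q (sub ∘ there) qs

-- Minors get smaller

size : MGraph → ℕ
size G = length (verts G) + length (edges G)

length-drop : ∀ {a} {A : Set a} (p : A → Bool) {x xs} → x ∈ xs → ¬ T (p x) → length (filterᵇ p xs) < length xs
length-drop p {xs = xs} x∈ ¬p = filter-notAll (T? ∘ p) xs (lose x∈ ¬p)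

size-delete : ∀ {e G} → e ∈ edges G → size (deleteAll (e ∷ []) G) < size G
size-delete {e} {G} e∈ = +-mono-≤-< (≤-refl {length (verts G)}) (length-drop _ e∈ λ t → T-not⁻ t (anyE⁺ {e} {e ∷ []} (here refl)))

size-merge : ∀ g {u v V E} → Nbr E u v → size (graph (mergeV g u v V) (map (renameE u v) (dropE u v E))) < size (graph V E)
size-merge g {u} {v} {V} {E} nb = +-mono-≤-<
  (≤-trans (≤-reflexive (length-map (updAt u g) (without v V))) (length-filter (T? ∘ λ e → not (proj₁ e ≡ᵇ v)) V))
  (subst (_< length E) (sym (length-map (renameE u v) (dropE u v E))) (dropped nb))
  where
  dropped : Nbr E u v → length (dropE u v E) < length E
  dropped (inj₁ m) = length-drop _ m λ t → T-not⁻ t (eitherWay⁺ {u} {v} (inj₁ (refl , refl)))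
  dropped (inj₂ m) = length-drop _ m λ t → T-not⁻ t (eitherWay⁺ {u} {v} (inj₂ (refl , refl)))

size-contract : ∀ {e G} → IsMarkedForest G → e ∈ edges G → size (contract1 e G) < size G
size-contract {u , v} {graph V E} fo e∈ with contract1-≡ fo e∈
... | mv , _ , eq = subst (λ H → size H < size (graph V E)) (sym eq) (size-merge (_∔ mv) {V = V} (inj₁ e∈))

Smaller : MGraph → MGraph → Set
Smaller G H = IsMarkedForest H × size H ≤ size G

-- An empty `P` returns `G` itself, so the decrease is strict only when there is a first edge; hence
-- two mutual statements. The length `n` drives the recursion because the renamed rest of `P` is not
-- a subterm.
minors-smaller : ∀ n {P G} → length P ≡ n → IsMarkedForest G → PendantList (edges G) P → All (Smaller G) (minors P G)
minors-shrink : ∀ n {e P G} → length P ≡ n → IsMarkedForest G → PendantList (edges G) (e ∷ P) →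
  All (λ H → IsMarkedForest H × size H < size G) (minors (e ∷ P) G)

minors-smaller zero {[]} {G} _ fo _ = subst (Smaller G) (sym (deleteAll-[] G)) (fo , ≤-refl) ∷ []
minors-smaller (suc n) {e ∷ P} len fo pl = All.map (λ { (f , s) → f , <⇒≤ s }) (minors-shrink n (cong pred len) fo pl)

minors-shrink n {u , v} {P} {G} len fo pl@(mkPendantList (pe ∷ _) _) = subst (All _) (sym (minors-∷ fo pl)) (All.++⁺
  (All.map (λ { (f , s) → f , ≤-trans (s≤s s) (size-contract fo (proj₁ pe)) })
    (minors-smaller n (trans (length-map _ P) len) (forest-contract fo pe) (pendant-contract fo pl)))
  (All.map (λ { (f , s) → f , ≤-trans (s≤s s) (size-delete {G = G} (proj₁ pe)) })
    (minors-smaller n len (forest-delete ((u , v) ∷ []) {G} fo) (pendant-delete {G = G} pl))))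

minors-decrease : ∀ {P G f} → IsMarkedForest G → PendantList (edges G) P → f ∈ P →
  All (λ H → IsMarkedForest H × size H < size G) (minors P G)
minors-decrease {_ ∷ P} fo pl _ = minors-shrink (length P) refl fo pl

-- Degrees, leaves and absorption

incᵇ : ℕ → Edge → Bool
incᵇ x e = (proj₁ e ≡ᵇ x) ∨ (proj₂ e ≡ᵇ x)

incᵇ⁻ : ∀ x e → T (incᵇ x e) → Inc x e
incᵇ⁻ x (a , b) t = Sum.map (≡ᵇ⇒≡ a x) (≡ᵇ⇒≡ b x) (∨⁻ {a ≡ᵇ x} t)

incᵇ⁺ : ∀ {x e} → Inc x e → T (incᵇ x e)
incᵇ⁺ {x} (inj₁ refl) = ∨⁺ (inj₁ (≡ᵇ-refl x))
incᵇ⁺ {x} {a , .x} (inj₂ refl) = ∨⁺ {a ≡ᵇ x} (inj₂ (≡ᵇ-refl x))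

deg1⇒leaf : ∀ {V E x} → deg (graph V E) x ≡ 1 → ∃ λ e → e ∈ E × Leaf E x e
deg1⇒leaf {V} {E} {x} eq with filterᵇ (incᵇ x) E in f
deg1⇒leaf {V} {E} {x} eq | e ∷ [] =
  let (e∈ , t) = ∈-filterᵇ⁻ (incᵇ x) {xs = E} (subst (e ∈_) (sym f) (here refl)) in
  e , e∈ , incᵇ⁻ x e t , λ g∈ i → only (subst (_ ∈_) f (∈-filterᵇ⁺ (incᵇ x) g∈ (incᵇ⁺ i)))
  where
  only : ∀ {g} → g ∈ e ∷ [] → g ≡ e
  only (here q) = q

deg1-avoids : ∀ {V E u v} → deg (graph V E) v ≡ 1 → Nbr E u v → Avoids v (dropE u v E)
deg1-avoids {V} {E} {u} {v} eq nb m inc with deg1⇒leaf {V} {E} eq | dropE-∈⁻ u v E m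
... | e , _ , _ , only | f∈ , ¬s with only f∈ inc
...   | refl with nb
...     | inj₁ n with refl ← only n (inj₂ refl) = ¬s (inj₁ (refl , refl))
...     | inj₂ n with refl ← only n (inj₁ refl) = ¬s (inj₂ (refl , refl))

absorb-≡ : ∀ {u v V E mv} → IsMarkedForest (graph V E) → (v , mv) ∈ V →
  absorb u v (graph V E) ≡ graph (mergeV absorbMark u v V) (map (renameE u v) (dropE u v E))
absorb-≡ {u} {v} fo v∈ = mergeWith-≡ (λ mu _ → absorbMark mu) u v (unique-ids (forest-valid fo)) v∈

forest-absorb : ∀ {u v G mv} → IsMarkedForest G → (v , mv) ∈ verts G → deg G v ≡ 1 → Adj G u v → IsMarkedForest (absorb u v G)
forest-absorb {u} {v} {graph V E} fo v∈ dv nb = subst IsMarkedForest (sym (absorb-≡ fo v∈))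
  (forest-merge absorbMark fo nb (inj₂ (deg1-avoids {V} {E} {u} {v} dv nb)))

-- The edge list enters a block product only through the adjacency relation

module _ (A B : List Edge) (adj : ∀ x y → adjᵇ A x y ≡ adjᵇ B x y) where

  stage-cong : ∀ vs n v → stage vs A n v ≡ stage vs B n v
  stage-cong vs zero v = refl
  stage-cong vs (suc n) v = trans (cong (grow vs A) (stage-cong vs n v)) (filterᵇ-cong vs λ {y} _ →
    cong (elem y (stage vs B n v) ∨_) (cong or (map-cong (λ x → adj x y) (stage vs B n v))))

  reach-cong : ∀ V x → reach (graph V A) x ≡ reach (graph V B) x
  reach-cong V x = stage-cong (map proj₁ V) (length (map proj₁ V)) x

  repsFrom-cong : ∀ V prev vs → repsFrom (graph V A) prev vs ≡ repsFrom (graph V B) prev vs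
  repsFrom-cong V prev [] = refl
  repsFrom-cong V prev (v ∷ vs) rewrite reach-cong V (proj₁ v) | repsFrom-cong V (prev ∷ʳ proj₁ v) vs = refl

  compMark-cong : ∀ V v → compMark (graph V A) v ≡ compMark (graph V B) v
  compMark-cong V v rewrite reach-cong V (proj₁ v) = refl

Nbr-adjᵇ : ∀ A B → (∀ {x y} → Nbr A x y → Nbr B x y) → (∀ {x y} → Nbr B x y → Nbr A x y) → ∀ x y → adjᵇ A x y ≡ adjᵇ B x y
Nbr-adjᵇ A B f g x y = T-ext (λ t → adjᵇ⁺ {B} (f (adjᵇ⁻ t))) (λ t → adjᵇ⁺ {A} (g (adjᵇ⁻ t)))

compMark-single : ∀ i m → compMark (graph ((i , m) ∷ []) []) (i , m) ≡ m
compMark-single i m = cong (foldr (λ e n → proj₂ e ∔ n) m)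
  (filterᵇ-none (λ e → elem (proj₁ e) (reach (graph ((i , m) ∷ []) []) i) ∧ not (proj₁ e ≡ᵇ i)) ((i , m) ∷ [])
    λ { (here refl) t → T-not⁻ (proj₂ (∧⁻ {elem i (reach (graph ((i , m) ∷ []) []) i)} t)) (≡ᵇ-refl i) })

connᵇ-saturated : ∀ {V E} → Valid V E → ∀ {i} → i ∈ map proj₁ V → Saturated (connᵇ V E i) E
connᵇ-saturated {V} {E} va {i} i∈ = All.tabulate λ { {a , b} m → T-ext
  (λ t → connᵇ⁺ va b i∈ (connᵇ⁻ V E i a t ◅◅ (inj₁ m ◅ ε)))
  (λ t → connᵇ⁺ va a i∈ (connᵇ⁻ V E i b t ◅◅ (inj₂ m ◅ ε))) }

restrict-filter : ∀ {B : Set} (f : B → ℕ) (p q r : ℕ → Bool) (xs : List B) → (∀ i → p i ∧ q i ≡ r i) →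
  filterᵇ (q ∘ f) (filterᵇ (p ∘ f) xs) ≡ filterᵇ (r ∘ f) xs
restrict-filter f p q r xs h = trans (filterᵇ-filterᵇ (q ∘ f) (p ∘ f) xs) (filterᵇ-cong xs λ {x} _ → h (f x))

restrict : (ℕ → Bool) → MGraph → MGraph
restrict p G = graph (restrictV p (verts G)) (restrictE p (edges G))

restrict-restrict : ∀ p q r G → (∀ i → p i ∧ q i ≡ r i) → restrict q (restrict p G) ≡ restrict r G
restrict-restrict p q r (graph V E) h = cong₂ graph (restrict-filter proj₁ p q r V h) (restrict-filter proj₁ p q r E h)

-- The subset expansion: deletion and contraction, components, absorption

module Polynomial {c ℓ : Level} (R : CommutativeRing c ℓ) (φ : ℕ → ℕ → CommutativeRing.Carrier R) where
  open CommutativeRing R renaming (_+_ to _+ᵣ_; _*_ to _*ᵣ_; refl to ≈-refl; sym to ≈-sym; trans to ≈-trans; reflexive to ≈-reflexive)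
  open Sums R
  open Blocks R φ
  open WithRing R using (Mpoly)
  open SetoidReasoning setoid

  M : MGraph → Carrier
  M = Mpoly val

  blockProd-Nbr : ∀ V A B → (∀ {x y} → Nbr A x y → Nbr B x y) → (∀ {x y} → Nbr B x y → Nbr A x y) → blockProd V A ≡ blockProd V B
  blockProd-Nbr V A B f g = cong prodR (trans (map-cong (λ v → cong val (compMark-cong A B adj V v)) (reps (graph V A)))
    (cong (map (λ r → val (compMark (graph V B) r))) (repsFrom-cong A B adj V [] V)))
    where
    adj = Nbr-adjᵇ A B f g

  blockProd-↭ : ∀ V A B → A ↭ B → blockProd V A ≈ blockProd V B
  blockProd-↭ V A B p = ≈-reflexive (blockProd-Nbr V A B (Sum.map (∈-resp-↭ p) (∈-resp-↭ p)) (Sum.map (∈-resp-↭ (↭-sym p)) (∈-resp-↭ (↭-sym p))))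

  -- The edge may be stored in either orientation while the merge always keeps `u`: absorption needs
  -- the leaf to be `v`. A block product sees only adjacency, so the stored orientation can be
  -- reversed.
  M-deletion-contraction : ∀ {V E u v mv} → IsMarkedForest (graph V E) → Nbr E u v → (v , mv) ∈ V →
    M (graph V E) ≈ M (graph (mergeV (_∔ mv) u v V) (map (renameE u v) (dropE u v E))) +ᵣ M (graph V (dropE u v E))
  M-deletion-contraction {V} {E} {u} {v} {mv} fo nb v∈ = go nb
    where
    va = forest-valid fo
    V′ = mergeV (_∔ mv) u v V
    D = dropE u v E
    u∈ = proj₂ (lookup-mark (Nbr-endpoint (endpoints va) (Nbr-sym {E} nb)))
    u≢v = forest-loopless {graph V E} fo nb
    along : ∀ {e} → e ∈ E → SameEdge e (u , v) → (∀ A → blockProd V (e ∷ A) ≡ blockProd V ((u , v) ∷ A)) →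
      M (graph V E) ≈ M (graph V′ (map (renameE u v) D)) +ᵣ M (graph V D)
    along {e} e∈ s orient with dropE-split (forest-simple fo) e∈ s
    ... | E₁ , E₂ , eq , eqD = begin
      subsetSum (blockProd V) E                                       ≡⟨ cong (subsetSum (blockProd V)) eq ⟩
      subsetSum (blockProd V) (E₁ ++ e ∷ E₂)                          ≈⟨ subsetSum-shift (blockProd V) E₁ e E₂ (blockProd-↭ V) ⟩
      subsetSum (blockProd V) (e ∷ E₁ ++ E₂)                          ≡⟨ cong (λ D → subsetSum (blockProd V) (e ∷ D)) eqD ⟨
      subsetSum (blockProd V) (e ∷ D)                                 ≈⟨ subsetSum-∷ (blockProd V) e D ⟩
      subsetSum (blockProd V ∘ (e ∷_)) D +ᵣ subsetSum (blockProd V) D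
        ≈⟨ +-congʳ (subsetSum-cong _ D (endpoints (Valid-⊆ (λ m → proj₁ (dropE-∈⁻ u v E m)) va)) λ A es →
             ≈-trans (≈-reflexive (orient A)) (blockProd-contract (mkValid (unique-ids va) es) u∈ v∈ u≢v)) ⟩
      subsetSum (blockProd V′ ∘ map (renameE u v)) D +ᵣ subsetSum (blockProd V) D
        ≈⟨ +-congʳ (subsetSum-map (blockProd V′) (renameE u v) D) ⟨
      subsetSum (blockProd V′) (map (renameE u v) D) +ᵣ subsetSum (blockProd V) D ∎
    flip : ∀ {a b A x y} → Nbr ((a , b) ∷ A) x y → Nbr ((b , a) ∷ A) x y
    flip (inj₁ (here refl)) = inj₂ (here refl)
    flip (inj₂ (here refl)) = inj₁ (here refl)
    flip (inj₁ (there m)) = inj₁ (there m)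
    flip (inj₂ (there m)) = inj₂ (there m)
    go : Nbr E u v → M (graph V E) ≈ M (graph V′ (map (renameE u v) D)) +ᵣ M (graph V D)
    go (inj₁ m) = along m (inj₁ (refl , refl)) λ _ → refl
    go (inj₂ m) = along m (inj₂ (refl , refl)) λ A → blockProd-Nbr V _ _ flip flip

  M-split : ∀ {V E} p → Valid V E → Saturated p E →
    M (graph V E) ≈ M (restrict p (graph V E)) *ᵣ M (restrict (not ∘ p) (graph V E))
  M-split {V} {E} p va sat = ≈-trans
    (subsetSum-cong _ E (All.zip (endpoints va , sat)) λ A h → let (es , s) = All.unzip h in blockProd-split p (mkValid (unique-ids va) es) s)
    (subsetSum-filter (blockProd (restrictV p V)) (blockProd (restrictV (not ∘ p) V)) (p ∘ proj₁) E)

  M-single : ∀ i m → M (graph ((i , m) ∷ []) []) ≈ val m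
  M-single i m = ≈-trans (+-identityʳ _) (≈-trans (*-identityʳ _) (≈-reflexive (cong val (compMark-single i m))))

  M-empty : M (graph [] []) ≈ 1#
  M-empty = +-identityʳ 1#

  -- Splits off the component of one representative at a time. What remains is the restriction to
  -- the union `near L` of the components of the later representatives, which is again saturated.
  M-components : ∀ {G} → Valid (verts G) (edges G) → M G ≈ prodR (map M (components G))
  M-components {graph V E} va = ≈-trans (≈-reflexive (cong M (sym whole)))
    (≈-trans (go (reps G) (reps-⊆ va) (reps-pairs va)) (≈-reflexive (cong prodR (map-∘ (reps G)))))
    where
    G = graph V E
    cls : Entry → ℕ → Bool
    cls r = connᵇ V E (proj₁ r)
    near : List Entry → ℕ → Bool
    near L i = any (λ r → cls r i) L
    covered-by-reps : ∀ {i} → i ∈ map proj₁ V → T (near (reps G) i)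
    covered-by-reps {i} i∈ with reps-cover va i∈
    ... | r , r∈ , c = any⁺ (λ r → cls r i) (lose r∈ (connᵇ⁺ va i (∈-map⁺ proj₁ (reps-⊆ va r∈)) (Conn-sym c)))
    whole : restrict (near (reps G)) G ≡ G
    whole = cong₂ graph (filterᵇ-all _ V λ m → covered-by-reps (∈-map⁺ proj₁ m))
                        (filterᵇ-all _ E λ m → covered-by-reps (proj₁ (All.lookup (endpoints va) m)))
    near-saturated : ∀ L → (∀ {r} → r ∈ L → r ∈ V) → Saturated (near L) E
    near-saturated [] sub = All.tabulate λ _ → refl
    near-saturated (r ∷ L) sub = All.zipWith (λ { (a , b) → cong₂ _∨_ a b })
      (connᵇ-saturated va (∈-map⁺ proj₁ (sub (here refl))) , near-saturated L (sub ∘ there))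
    go : ∀ L → (∀ {r} → r ∈ L → r ∈ V) → AllPairs (λ r s → ¬ Conn E (proj₁ r) (proj₁ s)) L →
      M (restrict (near L) G) ≈ prodR (map (M ∘ componentOf G) L)
    go [] sub [] = ≈-trans (≈-reflexive (cong M (cong₂ graph (filterᵇ-none _ V λ _ ()) (filterᵇ-none _ E λ _ ())))) M-empty
    go (r ∷ L) sub (pr ∷ pL) = begin
      M H
        ≈⟨ M-split (cls r) (Valid-restrict (near-saturated (r ∷ L) sub) va) (All.filter⁺ (T? ∘ near (r ∷ L) ∘ proj₁) (connᵇ-saturated va (∈-map⁺ proj₁ (sub (here refl))))) ⟩
      M (restrict (cls r) H) *ᵣ M (restrict (not ∘ cls r) H)
        ≡⟨ cong₂ (λ X Y → M X *ᵣ M Y)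
             (restrict-restrict (near (r ∷ L)) (cls r) (cls r) G λ i → absorbs (cls r i) (near L i))
             (restrict-restrict (near (r ∷ L)) (not ∘ cls r) (near L) G λ i → subtract (cls r i) (near L i) (disjoint i)) ⟩
      M (componentOf G r) *ᵣ M (restrict (near L) G)
        ≈⟨ *-congˡ (go L (sub ∘ there) pL) ⟩
      M (componentOf G r) *ᵣ prodR (map (M ∘ componentOf G) L) ∎
      where
      H = restrict (near (r ∷ L)) G
      absorbs : ∀ a b → (a ∨ b) ∧ a ≡ a
      absorbs true  b = refl
      absorbs false true  = refl
      absorbs false false = refl
      subtract : ∀ a b → (T b → ¬ T a) → (a ∨ b) ∧ not a ≡ b
      subtract true  true  h = ⊥-elim (h _ _)
      subtract true  false h = refl
      subtract false true  h = refl
      subtract false false h = refl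
      disjoint : ∀ i → T (near L i) → ¬ T (cls r i)
      disjoint i t k with find (any⁻ (λ r → cls r i) L t)
      ... | s , s∈ , k′ = All.lookup pr s∈ (connᵇ⁻ V E (proj₁ r) i k ◅◅ Conn-sym (connᵇ⁻ V E (proj₁ s) i k′))

  M-minors : ∀ n {P G} → length P ≡ n → IsMarkedForest G → PendantList (edges G) P → M G ≈ sumR (map M (minors P G))
  M-minors zero {[]} {G} _ fo _ = ≈-trans (≈-reflexive (cong M (sym (deleteAll-[] G)))) (≈-sym (+-identityʳ _))
  M-minors (suc n) {(u , v) ∷ P} {G} len fo pl@(mkPendantList (pe ∷ _) _) with contract1-≡ fo (proj₁ pe)
  ... | mv , v∈ , eq = begin
    M G
      ≈⟨ M-deletion-contraction fo (inj₁ (proj₁ pe)) v∈ ⟩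
    M (graph (mergeV (_∔ mv) u v (verts G)) (map (renameE u v) (dropE u v (edges G)))) +ᵣ M (graph (verts G) (dropE u v (edges G)))
      ≡⟨ cong₂ (λ X Y → M X +ᵣ M Y) (sym eq) (cong (graph (verts G)) (filterᵇ-cong (edges G) same)) ⟩
    M G/e +ᵣ M G-e
      ≈⟨ +-cong (M-minors n (trans (length-map _ P) (cong pred len)) (forest-contract fo pe) (pendant-contract fo pl))
                (M-minors n (cong pred len) (forest-delete (e ∷ []) {G} fo) (pendant-delete {G = G} pl)) ⟩
    sumR (map M (minors (map (renameE u v) P) G/e)) +ᵣ sumR (map M (minors P G-e))
      ≈⟨ sumR-++ (map M (minors (map (renameE u v) P) G/e)) (map M (minors P G-e)) ⟨
    sumR (map M (minors (map (renameE u v) P) G/e) ++ map M (minors P G-e))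
      ≡⟨ cong sumR (map-++ M (minors (map (renameE u v) P) G/e) (minors P G-e)) ⟨
    sumR (map M (minors (map (renameE u v) P) G/e ++ minors P G-e))
      ≡⟨ cong (sumR ∘ map M) (minors-∷ fo pl) ⟨
    sumR (map M (minors (e ∷ P) G)) ∎
    where
    e = (u , v)
    G/e = contract1 e G
    G-e = deleteAll (e ∷ []) G
    -- `dropE` removes both orientations and `deleteAll` only the stored one; in a simple graph
    -- these agree.
    same : ∀ {f} → f ∈ edges G → not (eitherWay u v f) ≡ not (any (eqE f) (e ∷ []))
    same {f} f∈ = cong not (T-ext
      (λ t → anyE⁺ {f} {e ∷ []} (here (same⇒≡ (forest-simple fo) f∈ (proj₁ pe) (eitherWay⁻ t))))
      (λ t → eitherWay⁺ (inj₁ (hit (anyE⁻ f (e ∷ []) t)))))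
      where
      hit : f ∈ e ∷ [] → proj₁ f ≡ u × proj₂ f ≡ v
      hit (here refl) = refl , refl

  module Absorption (z : Carrier) (φ-one : φ 1 0 ≈ z) (φ-rec : ∀ a b → φ (suc a) b ≈ φ (suc a) (suc b) +ᵣ z *ᵣ φ a b) where

    -- Deletion and contraction along the leaf edge. As `v` lies on no other edge, the renaming is
    -- void on the rest `D`, and in the deleted graph `v` splits off as the factor `z`. Both terms
    -- become sums over the subsets of `D` that differ only in the mark of `u`, and
    -- `blockProd-absorb` merges them subset by subset.
    M-absorb : ∀ {u v mv G} → IsMarkedForest G → (v , mv) ∈ verts G → Is10 mv → deg G v ≡ 1 → Adj G u v → M G ≈ M (absorb u v G)
    M-absorb {u} {v} {mv} {graph V E} fo v∈ (w1 , d0) dv nb with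
      lookup-mark (Nbr-endpoint (endpoints (forest-valid fo)) (Nbr-sym {E} nb))
    ... | mu , u∈ with updAt-zipper (subst Unique (sym (ids-without v V)) (Unique-filterᵇ _ (unique-ids (forest-valid fo))))
                        (∈-filterᵇ⁺ (λ e → not (proj₁ e ≡ᵇ v)) u∈ (T-not⁺ λ t → forest-loopless {graph V E} fo nb (≡ᵇ⇒≡ u v t)))
    ...   | U₁ , U₂ , plain , merged = begin
      M (graph V E)
        ≈⟨ M-deletion-contraction fo nb v∈ ⟩
      M (graph (mergeV (_∔ mv) u v V) (map (renameE u v) D)) +ᵣ M (graph V D)
        ≈⟨ +-cong (≈-reflexive (cong₂ (λ X Y → M (graph X Y)) (merged (_∔ mv)) unrenamed)) isolated ⟩
      subsetSum (blockProd (zip (mu ∔ mv))) D +ᵣ z *ᵣ subsetSum (blockProd (zip mu)) D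
        ≈⟨ +-congˡ (subsetSum-* z (blockProd (zip mu)) D) ⟨
      subsetSum (blockProd (zip (mu ∔ mv))) D +ᵣ subsetSum (λ A → z *ᵣ blockProd (zip mu) A) D
        ≈⟨ subsetSum-+ (blockProd (zip (mu ∔ mv))) (λ A → z *ᵣ blockProd (zip mu) A) D ⟨
      subsetSum (λ A → blockProd (zip (mu ∔ mv)) A +ᵣ z *ᵣ blockProd (zip mu) A) D
        ≈⟨ subsetSum-cong _ D (endpoints va-D) (λ A es → ≈-sym (blockProd-absorb z φ-rec U₁ U₂ u (mkValid (unique-ids va-D) es)
             refl refl (trans (cong (w mu +_) w1) (ℕ.+-comm (w mu) 1)) (cong suc (trans (cong (d mu +_) d0) (ℕ.+-identityʳ (d mu)))))) ⟩
      subsetSum (blockProd (zip (absorbMark mu))) D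
        ≡⟨ cong₂ (λ X Y → M (graph X Y)) (sym (merged absorbMark)) (sym unrenamed) ⟩
      M (graph (mergeV absorbMark u v V) (map (renameE u v) D))
        ≡⟨ cong M (absorb-≡ fo v∈) ⟨
      M (absorb u v (graph V E)) ∎
      where
      va = forest-valid fo
      D = dropE u v E
      av : Avoids v D
      av = deg1-avoids {V} {E} {u} {v} dv nb
      zip : Mark → List Entry
      zip m = U₁ ++ (u , m) ∷ U₂
      p : ℕ → Bool
      p i = i ≡ᵇ v
      off : ∀ {f x} → f ∈ D → Inc x f → ¬ T (p x)
      off f∈ i t = av f∈ (subst (λ y → Inc y _) (≡ᵇ⇒≡ _ v t) i)
      sat : Saturated p D
      sat = All.tabulate λ f∈ → T-ext (⊥-elim ∘ off f∈ (inj₁ refl)) (⊥-elim ∘ off f∈ (inj₂ refl))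
      D-rest : restrictE (not ∘ p) D ≡ D
      D-rest = filterᵇ-all _ D λ f∈ → T-not⁺ (off f∈ (inj₁ refl))
      unrenamed : map (renameE u v) D ≡ D
      unrenamed = trans (map-cong-∈ D λ { {a , b} f∈ → cong₂ _,_ (renameV-≢ u v λ { refl → av f∈ (inj₁ refl) }) (renameV-≢ u v λ { refl → av f∈ (inj₂ refl) }) }) (map-id D)
      va′ : Valid V D
      va′ = Valid-⊆ (λ m → proj₁ (dropE-∈⁻ u v E m)) va
      va-D : Valid (zip mu) D
      va-D = subst₂ Valid plain D-rest (Valid-restrict (Saturated-not sat) va′)
      alone : ∀ {W : List Entry} → Unique (map proj₁ W) → (v , mv) ∈ W → restrictV p W ≡ (v , mv) ∷ []
      alone {_ ∷ W} (f ∷ us) (here refl) = trans (filter-accept (T? ∘ p ∘ proj₁) {v , mv} {W} (≡ᵇ-refl v))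
        (cong ((v , mv) ∷_) (filterᵇ-none _ W λ {x} x∈ t → All.lookup f (∈-map⁺ proj₁ x∈) (sym (≡ᵇ⇒≡ (proj₁ x) v t))))
      alone {y ∷ W} (f ∷ us) (there m) = trans
        (filter-reject (T? ∘ p ∘ proj₁) {y} {W} (λ t → All.lookup f (∈-map⁺ proj₁ m) (≡ᵇ⇒≡ (proj₁ y) v t))) (alone us m)
      isolated : M (graph V D) ≈ z *ᵣ M (graph (zip mu) D)
      isolated = ≈-trans (M-split p va′ sat) (*-cong
        (≈-trans (≈-reflexive (cong₂ (λ X Y → M (graph X Y)) (alone (unique-ids va) v∈) (filterᵇ-none _ D λ f∈ → off f∈ (inj₁ refl))))
          (≈-trans (M-single v mv) (≈-trans (≈-reflexive (cong₂ φ w1 d0)) φ-one)))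
        (≈-reflexive (cong₂ (λ X Y → M (graph X Y)) plain D-rest)))

    M-core : ∀ {G G′} → IsMarkedForest G → Core G G′ → IsMarkedForest G′ × M G ≈ M G′
    M-core fo (done _) = fo , ≈-refl
    M-core fo (step u v mv v∈ (dv , is10) adj co) with M-core (forest-absorb fo v∈ dv adj) co
    ... | fo′ , eq = fo′ , ≈-trans (M-absorb fo v∈ is10 dv adj) eq

-- The recursion for the values on single vertices

module Bullet {c ℓ : Level} (R : CommutativeRing c ℓ) (z : ℕ → ℕ → CommutativeRing.Carrier R) where
  open CommutativeRing R renaming (_+_ to _+ᵣ_; _*_ to _*ᵣ_; refl to ≈-refl; sym to ≈-sym; trans to ≈-trans; reflexive to ≈-reflexive)
  open RS (Semiring.rawSemiring semiring) using () renaming (_×_ to _·_; _^_ to _^ᵣ_)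
  open Mult +-monoid using (×-congˡ; ×-homo-+; ×-homo-1)
  open RingProperties ring using (-1*x≈-x)
  open CommutativeSemigroup *-commutativeSemigroup using () renaming (interchange to *-interchange)
  open Sums R
  open SetoidReasoning setoid

  sumTo : (ℕ → Carrier) → ℕ → Carrier
  sumTo f n = sumR (applyUpTo f n)

  sumTo-cong : ∀ {f g} n → (∀ i → f i ≈ g i) → sumTo f n ≈ sumTo g n
  sumTo-cong zero h = ≈-refl
  sumTo-cong (suc n) h = +-cong (h 0) (sumTo-cong n (h ∘ suc))

  sumTo-+ : ∀ f g n → sumTo (λ i → f i +ᵣ g i) n ≈ sumTo f n +ᵣ sumTo g n
  sumTo-+ f g zero = ≈-sym (+-identityˡ 0#)
  sumTo-+ f g (suc n) = ≈-trans (+-congˡ (sumTo-+ (f ∘ suc) (g ∘ suc) n)) (+-interchange _ _ _ _)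

  sumTo-* : ∀ a f n → sumTo (λ i → a *ᵣ f i) n ≈ a *ᵣ sumTo f n
  sumTo-* a f zero = ≈-sym (zeroʳ a)
  sumTo-* a f (suc n) = ≈-trans (+-congˡ (sumTo-* a (f ∘ suc) n)) (≈-sym (distribˡ a _ _))

  sumTo-last : ∀ f n → sumTo f (suc n) ≈ sumTo f n +ᵣ f n
  sumTo-last f n = ≈-trans (≈-reflexive (cong sumR (sym (applyUpTo-∷ʳ f n))))
    (≈-trans (sumR-++ (applyUpTo f n) (f n ∷ [])) (+-congˡ (+-identityʳ (f n))))

  z₁ : Carrier
  z₁ = z 1 0

  term : ℕ → ℕ → ℕ → Carrier
  term a b i = ((- 1#) ^ᵣ i) *ᵣ ((b C i) · 1#) *ᵣ z (a ∸ i) 0 *ᵣ (z₁ ^ᵣ i)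

  -- Dbullet z m is bullet (w m) (d m).
  bullet : ℕ → ℕ → Carrier
  bullet a b = sumR (map (term a b) (upTo (suc b)))

  bullet-sumTo : ∀ a b → bullet a b ≈ sumTo (term a b) (suc b)
  bullet-sumTo a b = ≈-reflexive (cong sumR (map-upTo (term a b) (suc b)))

  bullet-one : bullet 1 0 ≈ z₁
  bullet-one = begin
    ((1# *ᵣ (1 · 1#)) *ᵣ z₁) *ᵣ 1# +ᵣ 0#   ≈⟨ +-identityʳ _ ⟩
    ((1# *ᵣ (1 · 1#)) *ᵣ z₁) *ᵣ 1#         ≈⟨ *-identityʳ _ ⟩
    (1# *ᵣ (1 · 1#)) *ᵣ z₁                 ≈⟨ *-congʳ (≈-trans (*-identityˡ _) (×-homo-1 1#)) ⟩
    1# *ᵣ z₁                               ≈⟨ *-identityˡ z₁ ⟩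
    z₁                                     ∎

  term-vanish : ∀ a b → term a b (suc b) ≈ 0#
  term-vanish a b = begin
    ((- 1#) ^ᵣ suc b) *ᵣ ((b C suc b) · 1#) *ᵣ z (a ∸ suc b) 0 *ᵣ (z₁ ^ᵣ suc b)  ≈⟨ *-congʳ (*-congʳ (*-congˡ (×-congˡ (k>n⇒nCk≡0 (ℕ.n<1+n b))))) ⟩
    ((- 1#) ^ᵣ suc b) *ᵣ 0# *ᵣ z (a ∸ suc b) 0 *ᵣ (z₁ ^ᵣ suc b)                  ≈⟨ *-congʳ (≈-trans (*-congʳ (zeroʳ _)) (zeroˡ _)) ⟩
    0# *ᵣ (z₁ ^ᵣ suc b)                                                        ≈⟨ zeroˡ _ ⟩
    0#                                                                        ∎

  -- Besides Pascal's rule, `suc a ∸ suc i` computes to `a ∸ i`, so both summands share the factor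
  -- `Z`. The extra sign and the extra `z₁` in the second combine into `- z₁`.
  term-pascal : ∀ a b i → term (suc a) (suc b) (suc i) ≈ term (suc a) b (suc i) +ᵣ (- z₁) *ᵣ term a b i
  term-pascal a b i = begin
    s *ᵣ ((suc b C suc i) · 1#) *ᵣ Z *ᵣ (z₁ *ᵣ y)
      ≈⟨ *-congʳ (*-congʳ (*-congˡ (≈-trans (×-congˡ (trans (sym (nCk+nC[k+1]≡[n+1]C[k+1] b i)) (ℕ.+-comm (b C i) (b C suc i)))) (×-homo-+ 1# (b C suc i) (b C i))))) ⟩
    s *ᵣ (k′ +ᵣ k) *ᵣ Z *ᵣ (z₁ *ᵣ y)
      ≈⟨ ≈-trans (*-congʳ (≈-trans (*-congʳ (distribˡ s k′ k)) (distribʳ Z _ _))) (distribʳ _ _ _) ⟩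
    s *ᵣ k′ *ᵣ Z *ᵣ (z₁ *ᵣ y) +ᵣ ((- 1#) *ᵣ x) *ᵣ k *ᵣ Z *ᵣ (z₁ *ᵣ y)
      ≈⟨ +-congˡ (*-congʳ (≈-trans (*-congʳ (*-assoc _ _ _)) (*-assoc _ _ _))) ⟩
    s *ᵣ k′ *ᵣ Z *ᵣ (z₁ *ᵣ y) +ᵣ ((- 1#) *ᵣ (x *ᵣ k *ᵣ Z)) *ᵣ (z₁ *ᵣ y)
      ≈⟨ +-congˡ (*-interchange _ _ _ _) ⟩
    s *ᵣ k′ *ᵣ Z *ᵣ (z₁ *ᵣ y) +ᵣ ((- 1#) *ᵣ z₁) *ᵣ (x *ᵣ k *ᵣ Z *ᵣ y)
      ≈⟨ +-congˡ (*-congʳ (-1*x≈-x z₁)) ⟩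
    s *ᵣ k′ *ᵣ Z *ᵣ (z₁ *ᵣ y) +ᵣ (- z₁) *ᵣ (x *ᵣ k *ᵣ Z *ᵣ y) ∎
    where
    s = (- 1#) ^ᵣ suc i
    x = (- 1#) ^ᵣ i
    y = z₁ ^ᵣ i
    Z = z (a ∸ i) 0
    k = (b C i) · 1#
    k′ = (b C suc i) · 1#

  bullet-rec : ∀ a b → bullet (suc a) b ≈ bullet (suc a) (suc b) +ᵣ z₁ *ᵣ bullet a b
  bullet-rec a b = ≈-sym (begin
    bullet (suc a) (suc b) +ᵣ z₁ *ᵣ bullet a b
      ≈⟨ +-cong (bullet-sumTo (suc a) (suc b)) (*-congˡ (bullet-sumTo a b)) ⟩
    (h 0 +ᵣ sumTo (h ∘ suc) (suc b)) +ᵣ z₁ *ᵣ S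
      -- The initial terms `h 0` and `f 0` agree by computation; Pascal's rule is applied to the
      -- later terms only.
      ≈⟨ +-congʳ (+-congˡ (≈-trans (sumTo-cong (suc b) (term-pascal a b)) (≈-trans (sumTo-+ (f ∘ suc) (λ i → (- z₁) *ᵣ g i) (suc b)) (+-congˡ (sumTo-* (- z₁) g (suc b)))))) ⟩
    (f 0 +ᵣ (sumTo (f ∘ suc) (suc b) +ᵣ (- z₁) *ᵣ S)) +ᵣ z₁ *ᵣ S
      ≈⟨ ≈-trans (+-congʳ (≈-sym (+-assoc _ _ _))) (+-assoc _ _ _) ⟩
    sumTo f (suc (suc b)) +ᵣ ((- z₁) *ᵣ S +ᵣ z₁ *ᵣ S)
      ≈⟨ +-congˡ (≈-trans (≈-sym (distribʳ S _ _)) (≈-trans (*-congʳ (-‿inverseˡ z₁)) (zeroˡ S))) ⟩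
    sumTo f (suc (suc b)) +ᵣ 0#
      ≈⟨ ≈-trans (+-identityʳ _) (sumTo-last f (suc b)) ⟩
    -- The sum for `suc b` has one term more than the one for `b`; the surplus contains the binomial
    -- coefficient `b C suc b`, which is zero.
    sumTo f (suc b) +ᵣ f (suc b)
      ≈⟨ ≈-trans (+-congˡ (term-vanish (suc a) b)) (+-identityʳ _) ⟩
    sumTo f (suc b)
      ≈⟨ bullet-sumTo (suc a) b ⟨
    bullet (suc a) b ∎)
    where
    h = term (suc a) (suc b)
    f = term (suc a) b
    g = term a b
    S = sumTo g (suc b)

-- A forest with an edge has a leaf

Unique-⊆-length : ∀ {xs ys : List ℕ} → Unique xs → (∀ {x} → x ∈ xs → x ∈ ys) → length xs ≤ length ys
Unique-⊆-length {[]} _ _ = z≤n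
Unique-⊆-length {x ∷ xs} {ys} (f ∷ us) sub with ∈-∃++ (sub (here refl))
... | Y₁ , Y₂ , refl = subst (suc (length xs) ≤_) (sym count) (s≤s (Unique-⊆-length us sub′))
  where
  count : length (Y₁ ++ x ∷ Y₂) ≡ suc (length (Y₁ ++ Y₂))
  count = trans (length-++ Y₁) (trans (ℕ.+-suc (length Y₁) (length Y₂)) (cong suc (sym (length-++ Y₁))))
  sub′ : ∀ {y} → y ∈ xs → y ∈ Y₁ ++ Y₂
  sub′ y∈ with ∈-resp-↭ (shift x Y₁ Y₂) (sub (there y∈))
  ... | there m = m
  ... | here refl = ⊥-elim (All.lookup f y∈ refl)

AllPairs-++⁻ˡ : ∀ {a r} {A : Set a} {R : A → A → Set r} xs {ys} → AllPairs R (xs ++ ys) → AllPairs R xs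
AllPairs-++⁻ˡ [] _ = []
AllPairs-++⁻ˡ (x ∷ xs) (p ∷ ps) = All.++⁻ˡ xs p ∷ AllPairs-++⁻ˡ xs ps

-- Cuts a walk at `z` and leaves from there to `w`; with `w` the first vertex of the walk this
-- closes a cycle.
Linked-redirect : ∀ {a r} {A : Set a} {R : A → A → Set r} xs {z w ys} → Linked R (xs ++ z ∷ ys) → R z w → Linked R (xs ++ z ∷ w ∷ [])
Linked-redirect [] l r = r ∷ [-]
Linked-redirect (x ∷ []) (q ∷ l) r = q ∷ r ∷ [-]
Linked-redirect (x ∷ y ∷ xs) (q ∷ l) r = q ∷ Linked-redirect (y ∷ xs) l r

simple-unique : ∀ {E} → Simple E → Unique E
simple-unique = AllPairs.map (λ { ¬s refl → ¬s (inj₁ (refl , refl)) })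

_≟E_ : (e f : Edge) → Dec (e ≡ f)
_≟E_ = ≡-dec _≟_ _≟_

incident-∈⁻ : ∀ {x E L g} → filterᵇ (incᵇ x) E ≡ L → g ∈ L → g ∈ E × Inc x g
incident-∈⁻ {x} {E} {g = g} refl m = let (g∈ , t) = ∈-filterᵇ⁻ (incᵇ x) {xs = E} m in g∈ , incᵇ⁻ x g t

other-edge : ∀ {V E x e} → Simple E → e ∈ E → Inc x e → deg (graph V E) x ≢ 1 → ∃ λ f → f ∈ E × Inc x f × f ≢ e
other-edge {V} {E} {x} {e} simp e∈ inc ne with filterᵇ (incᵇ x) E in eq | Unique-filterᵇ (incᵇ x) (simple-unique simp)
... | [] | _ = ⊥-elim (nonempty (∈-filterᵇ⁺ (incᵇ x) e∈ (incᵇ⁺ inc)) eq)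
... | _ ∷ [] | _ = ⊥-elim (ne refl)
... | a ∷ b ∷ L | (a≢b ∷ _) ∷ _ with a ≟E e
...   | no a≢e   = let (a∈ , i) = incident-∈⁻ eq (here refl) in a , a∈ , i , a≢e
...   | yes refl = let (b∈ , i) = incident-∈⁻ eq (there (here refl)) in b , b∈ , i , a≢b ∘ sym

leaf⇒deg1 : ∀ {V E x e} → Simple E → e ∈ E → Leaf E x e → deg (graph V E) x ≡ 1
leaf⇒deg1 {V} {E} {x} {e} simp e∈ (inc , only) with deg (graph V E) x ≟ 1
... | yes q = q
... | no ne with other-edge {V} simp e∈ inc ne
...   | f , f∈ , i , f≢e = ⊥-elim (f≢e (only f∈ i))

other-neighbour : ∀ {V E x y} → Simple E → Nbr E x y → deg (graph V E) x ≢ 1 → ∃ λ z → Nbr E x z × z ≢ y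
other-neighbour {V} {E} {x} {y} simp nb ne = pick nb
  where
  pick : Nbr E x y → ∃ λ z → Nbr E x z × z ≢ y
  pick (inj₁ m) with other-edge {V} simp m (inj₁ refl) ne
  ... | (_ , z) , f∈ , inj₁ refl , f≢e = z , inj₁ f∈ , λ { refl → f≢e refl }
  ... | (z , _) , f∈ , inj₂ refl , f≢e = z , inj₂ f∈ , λ { refl → f≢e (same⇒≡ simp f∈ m (inj₂ (refl , refl))) }
  pick (inj₂ m) with other-edge {V} simp m (inj₂ refl) ne
  ... | (_ , z) , f∈ , inj₁ refl , f≢e = z , inj₁ f∈ , λ { refl → f≢e (same⇒≡ simp f∈ m (inj₂ (refl , refl))) }
  ... | (z , _) , f∈ , inj₂ refl , f≢e = z , inj₂ f∈ , λ { refl → f≢e refl }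

-- Extend a path until its end is a leaf; n bounds the number of extensions left.
path-leaf : ∀ {V E} → IsMarkedForest (graph V E) → ∀ n x y r → Unique (x ∷ y ∷ r) → Linked (Nbr E) (x ∷ y ∷ r) →
  (∀ {i} → i ∈ x ∷ y ∷ r → i ∈ map proj₁ V) → length (map proj₁ V) < n + length (x ∷ y ∷ r) → ∃ λ l → deg (graph V E) l ≡ 1
path-leaf fo zero x y r us li sub lt = ⊥-elim (ℕ.<-irrefl refl (≤-trans lt (Unique-⊆-length us sub)))
path-leaf {V} {E} fo@(_ , _ , _ , simp , acyc) (suc n) x y r us li@(xy ∷ _) sub lt with deg (graph V E) x ≟ 1
... | yes q = x , q
... | no ne with other-neighbour {V} simp xy ne
...   | z , xz , z≢y with z ∈? (x ∷ y ∷ r)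
...     | no z∉ = path-leaf fo n z x (y ∷ r)
                    (All.tabulate (λ { m refl → z∉ m }) ∷ us) (Nbr-sym {E} xz ∷ li)
                    (λ { (here refl) → Nbr-endpoint (endpoints (forest-valid fo)) xz ; (there m) → sub m })
                    (subst (length (map proj₁ V) <_) (sym (ℕ.+-suc n _)) lt)
...     | yes (here refl) = ⊥-elim (forest-loopless {graph V E} fo xz refl)
...     | yes (there (here refl)) = ⊥-elim (z≢y refl)
-- The path returns to itself at a vertex after `y`, so the segment from `x` to `z` has at least
-- three vertices and closes up along the edge `xz`.
...     | yes (there (there z∈)) with ∈-∃++ z∈
...       | r₁ , r₂ , refl = ⊥-elim (acyc (x ∷ y ∷ r₁ ++ z ∷ []) (long , prefix-unique , closed))
  where
  long : 2 ≤ length (y ∷ r₁ ++ z ∷ [])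
  long = s≤s (subst (1 ≤_) (sym (trans (length-++ r₁) (ℕ.+-comm (length r₁) 1))) (s≤s z≤n))
  prefix-unique : Unique (x ∷ y ∷ r₁ ++ z ∷ [])
  prefix-unique = AllPairs-++⁻ˡ (x ∷ y ∷ r₁ ++ z ∷ []) (subst Unique (cong (λ t → x ∷ y ∷ t) (sym (++-assoc r₁ (z ∷ []) r₂))) us)
  closed : Linked (Nbr E) ((x ∷ y ∷ r₁ ++ z ∷ []) ∷ʳ x)
  closed = subst (Linked (Nbr E)) (cong (λ t → x ∷ y ∷ t) (sym (++-assoc r₁ (z ∷ []) (x ∷ [])))) (Linked-redirect (x ∷ y ∷ r₁) li (Nbr-sym {E} xz))

forest-leaf : ∀ {V e E} → IsMarkedForest (graph V (e ∷ E)) → ∃ λ l → deg (graph V (e ∷ E)) l ≡ 1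
forest-leaf {V} {a , b} {E} fo = path-leaf fo (length (map proj₁ V)) a b []
  ((forest-loopless {graph V ((a , b) ∷ E)} fo ab ∷ []) ∷ [] ∷ []) (ab ∷ [-])
  (λ { (here refl) → Nbr-endpoint es (Nbr-sym {(a , b) ∷ E} ab) ; (there (here refl)) → Nbr-endpoint es ab })
  (ℕ.m<m+n _ (s≤s z≤n))
  where
  ab : Nbr ((a , b) ∷ E) a b
  ab = inj₁ (here refl)
  es = endpoints (forest-valid fo)

pendantᵇ : MGraph → Edge → Bool
pendantᵇ G e = (deg G (proj₁ e) ≡ᵇ 1) ∨ (deg G (proj₂ e) ≡ᵇ 1)

pendant-∈ : ∀ {G e x} → e ∈ edges G → Inc x e → deg G x ≡ 1 → e ∈ pendant G
pendant-∈ {G} {e} e∈ inc q = ∈-filterᵇ⁺ (pendantᵇ G) e∈ (∨⁺ {deg G (proj₁ e) ≡ᵇ 1} (Sum.map hit hit inc))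
  where
  hit : ∀ {a} → a ≡ _ → T (deg G a ≡ᵇ 1)
  hit refl = ℕ.≡⇒≡ᵇ _ 1 q

pendant-list : ∀ {G} → IsMarkedForest G → PendantList (edges G) (pendant G)
pendant-list {G} fo = mkPendantList (All.tabulate λ {e} m → pend⁻ e (∈-filterᵇ⁻ (pendantᵇ G) {xs = edges G} m))
  (Unique-filterᵇ (pendantᵇ G) (simple-unique (forest-simple {G} fo)))
  where
  leaf-at : ∀ e x → e ∈ edges G → Inc x e → deg G x ≡ 1 → Pendant (edges G) e
  leaf-at e x e∈ inc q with deg1⇒leaf {verts G} {edges G} {x} q
  ... | f , _ , _ , only = e∈ , x , inc , λ g∈ i → trans (only g∈ i) (sym (only e∈ inc))
  pend⁻ : ∀ e → e ∈ edges G × T (pendantᵇ G e) → Pendant (edges G) e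
  pend⁻ (a , b) (e∈ , t) with ∨⁻ {deg G a ≡ᵇ 1} t
  ... | inj₁ k = leaf-at (a , b) a e∈ (inj₁ refl) (≡ᵇ⇒≡ (deg G a) 1 k)
  ... | inj₂ k = leaf-at (a , b) b e∈ (inj₂ refl) (≡ᵇ⇒≡ (deg G b) 1 k)

pendantList-filter : ∀ {E P} q → PendantList E P → PendantList E (filterᵇ q P)
pendantList-filter q (mkPendantList ps ds) = mkPendantList (All.filter⁺ (T? ∘ q) ps) (Unique-filterᵇ q ds)

-- Keeps the recursion decreasing in the star case: after `e` is held back, a pendant edge must
-- remain. A centre of degree other than one has a second edge, whose outer end is a leaf because
-- every edge meets the centre.
star-second : ∀ {G e c m} → IsMarkedForest G → e ∈ edges G → (c , m) ∈ verts G → StarAt G c → deg G c ≢ 1 →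
  ∃ λ f → f ∈ filterᵇ (λ f → not (eqE f e)) (pendant G)
star-second {graph V E} {e} {c} fo e∈ c∈ star ne with other-edge {V} (forest-simple fo) e∈ (All.lookup star e∈) ne
... | f@(a , b) , f∈ , inc , f≢e = f , ∈-filterᵇ⁺ (λ f → not (eqE f e)) (outer inc) (T-not⁺ λ t → f≢e (eqE⁻ f e t))
  where
  loopless : ∀ {a b} → (a , b) ∈ E → a ≢ b
  loopless m = forest-loopless {graph V E} fo (inj₁ m)
  only : ∀ {y} → Inc c f → Inc y f → y ≢ c → ∀ {g} → g ∈ E → Inc y g → g ≡ f
  -- An edge `g` at the outer end `y` also meets `c`, so `g` and `f` both join `y` to `c`;
  -- simplicity identifies them.
  only {y} i j y≢c {g} g∈ k = same⇒≡ (forest-simple fo) g∈ f∈ (both k (All.lookup star g∈) j i)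
    where
    both : ∀ {g f} → Inc y g → Inc c g → Inc y f → Inc c f → SameEdge g f
    both (inj₁ refl) (inj₁ refl) _ _ = ⊥-elim (y≢c refl)
    both (inj₂ refl) (inj₂ refl) _ _ = ⊥-elim (y≢c refl)
    both _ _ (inj₁ refl) (inj₁ refl) = ⊥-elim (y≢c refl)
    both _ _ (inj₂ refl) (inj₂ refl) = ⊥-elim (y≢c refl)
    both (inj₁ refl) (inj₂ refl) (inj₁ refl) (inj₂ refl) = inj₁ (refl , refl)
    both (inj₁ refl) (inj₂ refl) (inj₂ refl) (inj₁ refl) = inj₂ (refl , refl)
    both (inj₂ refl) (inj₁ refl) (inj₁ refl) (inj₂ refl) = inj₂ (refl , refl)
    both (inj₂ refl) (inj₁ refl) (inj₂ refl) (inj₁ refl) = inj₁ (refl , refl)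
  outer : Inc c f → f ∈ pendant (graph V E)
  outer (inj₁ refl) = pendant-∈ {graph V E} f∈ (inj₂ refl)
    (leaf⇒deg1 {V} (forest-simple fo) f∈ (inj₂ refl , only (inj₁ refl) (inj₂ refl) (λ q → loopless f∈ (sym q))))
  outer (inj₂ refl) = pendant-∈ {graph V E} f∈ (inj₁ refl)
    (leaf⇒deg1 {V} (forest-simple fo) f∈ (inj₁ refl , only (inj₂ refl) (inj₁ refl) (loopless f∈)))

-- Case analysis on forests

Is10? : ∀ m → Dec (Is10 m)
Is10? m = (w m ≟ 1) ×-dec (d m ≟ 0)

hasAbsorbable? : ∀ G → Dec (HasAbsorbable G)
hasAbsorbable? G = map′ find (λ { (_ , m , a) → lose m a })
  (any? (λ e → (deg G (proj₁ e) ≟ 1) ×-dec Is10? (proj₂ e)) (verts G))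

starCentre10? : ∀ G → Dec (StarCentre10 G)
starCentre10? G = map′ centre (λ { (_ , _ , c∈ , s) → lose c∈ s })
  (any? (λ e → All.all? (λ f → (proj₁ f ≟ proj₁ e) ⊎-dec (proj₂ f ≟ proj₁ e)) (edges G) ×-dec Is10? (proj₂ e)) (verts G))
  where
  centre : Any (λ e → StarAt G (proj₁ e) × Is10 (proj₂ e)) (verts G) → StarCentre10 G
  centre a with find a
  ... | (c , m) , c∈ , s = c , m , c∈ , s

-- Absorption and passing to components decrease the size

absorb-shrink : ∀ {G v mv} → IsMarkedForest G → (v , mv) ∈ verts G → deg G v ≡ 1 →
  ∃ λ u → Adj G u v × IsMarkedForest (absorb u v G) × size (absorb u v G) < size G
absorb-shrink {graph V E} {v} fo v∈ q with deg1⇒leaf {V} {E} q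
... | (a , b) , e∈ , inc , _ = go inc
  where
  at : ∀ u → Nbr E u v → Adj (graph V E) u v × IsMarkedForest (absorb u v (graph V E)) × size (absorb u v (graph V E)) < size (graph V E)
  at u nb = nb , forest-absorb fo v∈ q nb ,
    subst (λ H → size H < size (graph V E)) (sym (absorb-≡ fo v∈)) (size-merge absorbMark {u} {v} {V} nb)
  go : Inc v (a , b) → ∃ λ u → Adj (graph V E) u v × IsMarkedForest (absorb u v (graph V E)) × size (absorb u v (graph V E)) < size (graph V E)
  go (inj₁ refl) = b , at b (inj₂ e∈)
  go (inj₂ refl) = a , at a (inj₁ e∈)

core-exists : ∀ n G → IsMarkedForest G → size G < n → ∃ λ G′ → Core G G′ × Smaller G G′
core-exists (suc n) G fo (s≤s lt) with hasAbsorbable? G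
... | no ¬h = G , done ¬h , fo , ≤-refl
... | yes ((v , mv) , v∈ , q , is10) with absorb-shrink fo v∈ q
...   | u , nb , fo′ , sm with core-exists n (absorb u v G) fo′ (≤-trans sm lt)
...     | G′ , co , fo″ , sm′ = G′ , step u v mv v∈ (q , is10) nb co , fo″ , ≤-trans sm′ (<⇒≤ sm)

component-forest : ∀ {G r} → IsMarkedForest G → r ∈ verts G → IsMarkedForest (componentOf G r)
component-forest {G} {r} fo r∈ = forest-restrict (connᵇ (verts G) (edges G) (proj₁ r)) fo (connᵇ-saturated va r∈ids) r∈ids
  (connᵇ⁺ va (proj₁ r) r∈ids ε)
  where
  va = forest-valid fo
  r∈ids = ∈-map⁺ proj₁ r∈

components-forest : ∀ {G} → IsMarkedForest G → All IsMarkedForest (components G)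
components-forest {G} fo = All.map⁺ (All.tabulate λ r∈ → component-forest fo (reps-⊆ (forest-valid fo) r∈))

AllPairs-other : ∀ {a r} {A : Set a} {R : A → A → Set r} → Symmetric R → ∀ {xs x} → AllPairs R xs → 1 < length xs → x ∈ xs →
  ∃ λ y → y ∈ xs × R x y
AllPairs-other s {_ ∷ y ∷ _} ((r ∷ _) ∷ _) _ (here refl) = y , there (here refl) , r
AllPairs-other s {x ∷ _} (p ∷ _) _ (there m) = x , here refl , s (All.lookup p m)
AllPairs-other s {_ ∷ []} _ (s≤s ()) (here _)

-- A second representative `s` exists and is missing from the component of `r`, which therefore has
-- fewer vertices and no more edges.
components-shrink : ∀ {G} → IsMarkedForest G → 1 < length (components G) →
  All (λ H → IsMarkedForest H × size H < size G) (components G)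
components-shrink {G} fo lt = All.map⁺ (All.tabulate shrink)
  where
  va = forest-valid fo
  shrink : ∀ {r} → r ∈ reps G → IsMarkedForest (componentOf G r) × size (componentOf G r) < size G
  shrink {r} r∈ with AllPairs-other (λ ¬c c → ¬c (Conn-sym c)) (reps-pairs va) (subst (1 <_) (length-map (componentOf G) (reps G)) lt) r∈
  ... | s , s∈ , ¬c = component-forest fo (reps-⊆ va r∈) , ℕ.+-mono-<-≤
    (length-drop _ (reps-⊆ va s∈) λ t → ¬c (connᵇ⁻ (verts G) (edges G) (proj₁ r) (proj₁ s) t))
    (length-filter (T? ∘ connᵇ (verts G) (edges G) (proj₁ r) ∘ proj₁) (edges G))

reps-nonempty : ∀ {G} → IsMarkedForest G → length (components G) ≢ 0
reps-nonempty {graph [] E} (ne , _) _ = ne refl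
reps-nonempty {G@(graph ((i , m) ∷ V) E)} fo eq with reps-cover (forest-valid fo) (here refl)
... | r , r∈ , _ = nonempty (∈-map⁺ (componentOf G) r∈) (empty eq)
  where
  empty : ∀ {xs : List MGraph} → length xs ≡ 0 → xs ≡ []
  empty {[]} _ = refl

connected-rep : ∀ G {r s} → Connected G → r ∈ reps G → s ∈ reps G → r ≡ s
connected-rep G conn = same (reps G) (trans (sym (length-map (componentOf G) (reps G))) conn)
  where
  same : ∀ (xs : List Entry) {x y} → length xs ≡ 1 → x ∈ xs → y ∈ xs → x ≡ y
  same (_ ∷ []) _ (here refl) (here refl) = refl

Conn-[] : ∀ {x y} → Conn [] x y → x ≡ y
Conn-[] ε = refl
Conn-[] (inj₁ () ◅ _)
Conn-[] (inj₂ () ◅ _)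

connected-edgeless : ∀ {V} → IsMarkedForest (graph V []) → Connected (graph V []) → ∃ λ i → ∃ λ m → V ≡ (i , m) ∷ []
connected-edgeless {[]} (ne , _) _ = ⊥-elim (ne refl)
connected-edgeless {(i , m) ∷ []} _ _ = i , m , refl
connected-edgeless {V@((i , m) ∷ (j , n) ∷ _)} fo conn =
  let va = forest-valid fo
      (r , r∈ , c) = reps-cover va (here refl)
      (s , s∈ , c′) = reps-cover va (there (here refl))
  in ⊥-elim (All.lookup (AllPairs.head (unique-ids va)) (here refl)
       (trans (Conn-[] c) (trans (cong proj₁ (connected-rep (graph V []) conn r∈ s∈)) (sym (Conn-[] c′)))))

-- Existence of a run of the recursion

module _ (_≤M_ : Rel Mark 0ℓ) (tot : IsTotalOrder _≡_ _≤M_) where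
  private module ≤M = IsTotalOrder tot

  largest : ∀ (L : List Entry) {x} → x ∈ L → ∃ λ i → ∃ λ m → (i , m) ∈ L × (∀ j n → (j , n) ∈ L → n ≤M m)
  largest ((i , m) ∷ []) _ = i , m , here refl , λ { _ _ (here refl) → ≤M.refl }
  largest ((i , m) ∷ y ∷ L) _ with largest (y ∷ L) (here refl)
  ... | j , n , n∈ , max with ≤M.total m n
  ...   | inj₁ m≤n = j , n , there n∈ , λ { _ _ (here refl) → m≤n ; k o (there o∈) → max k o o∈ }
  ...   | inj₂ n≤m = i , m , here refl , λ { _ _ (here refl) → ≤M.refl ; k o (there o∈) → ≤M.trans (max k o o∈) n≤m }

  module _ {c ℓ : Level} (R : CommutativeRing c ℓ) (val : Mark → CommutativeRing.Carrier R) where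
    open CommutativeRing R using (Carrier)
    open WithRing R
    open M′ _≤M_ val

    largest-leaf-edge : ∀ {G l} → IsMarkedForest G → deg G l ≡ 1 → ∃ λ e → LargestLeafEdge G e
    largest-leaf-edge {G} {l} fo q with deg1⇒leaf {verts G} {edges G} q
    ... | (a , b) , e∈ , inc , _ with lookup-mark (end inc)
      where
      end : Inc l (a , b) → l ∈ map proj₁ (verts G)
      end (inj₁ refl) = proj₁ (All.lookup (endpoints (forest-valid fo)) e∈)
      end (inj₂ refl) = proj₂ (All.lookup (endpoints (forest-valid fo)) e∈)
    ...   | m , l∈ with largest (filterᵇ (λ e → deg G (proj₁ e) ≡ᵇ 1) (verts G)) (∈-filterᵇ⁺ (λ e → deg G (proj₁ e) ≡ᵇ 1) l∈ (ℕ.≡⇒≡ᵇ _ 1 q))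
    ...     | i , n , n∈ , max with ∈-filterᵇ⁻ (λ e → deg G (proj₁ e) ≡ᵇ 1) {xs = verts G} n∈
    ...       | n∈V , t with deg1⇒leaf {verts G} {edges G} (≡ᵇ⇒≡ (deg G i) 1 t)
    ...         | e , e∈′ , inc′ , _ = e , i , n , n∈V , ≡ᵇ⇒≡ (deg G i) 1 t , e∈′ , inc′ ,
                  λ j mj j∈ dj → max j mj (∈-filterᵇ⁺ (λ e → deg G (proj₁ e) ≡ᵇ 1) j∈ (ℕ.≡⇒≡ᵇ _ 1 dj))

    collect : ∀ {Gs} → All (λ H → Σ Carrier (IsM′ H)) Gs → Σ (List Carrier) (Pointwise IsM′ Gs)
    collect [] = [] , []
    collect ((p , h) ∷ hs) = let (ps , hs′) = collect hs in p ∷ ps , h ∷ hs′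

    -- Components, cores and minors are computed graphs rather than subterms, so the recursion runs
    -- on a strict bound `n` for the size.
    M′-exists : ∀ n G → IsMarkedForest G → size G < n → Σ Carrier (IsM′ G)
    M′-exists (suc n) G@(graph V E) fo (s≤s lt) with length (components G) in eq
    ... | zero = ⊥-elim (reps-nonempty fo eq)
    ... | suc (suc k) = let many = subst (1 <_) (sym eq) (s≤s (s≤s z≤n))
                            (ps , hs) = collect (All.map (λ { (f , s) → M′-exists n _ f (≤-trans s lt) }) (components-shrink fo many))
                        in prodR ps , comps G ps many hs
    ... | suc zero with hasAbsorbable? G
    ...   | yes h@((v , mv) , v∈ , q , is10) =
            -- `core-exists` alone may return its input unchanged; one absorption is carried out by
            -- hand to make the decrease strict.
            let (u , nb , fo′ , sm)     = absorb-shrink fo v∈ q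
                (G′ , co , fo″ , sm′)   = core-exists n (absorb u v G) fo′ (≤-trans sm lt)
                (p , hp)                = M′-exists n G′ fo″ (≤-trans (s≤s sm′) (≤-trans sm lt))
            in p , core G G′ p eq h (step u v mv v∈ (q , is10) nb co) hp
    M′-exists (suc n) G@(graph V []) fo (s≤s lt) | suc zero | no ¬h =
      let (i , m , q) = connected-edgeless fo eq in val m , single G i m q refl
    M′-exists (suc n) G@(graph V (e₀ ∷ E₀)) fo (s≤s lt) | suc zero | no ¬h with forest-leaf fo | starCentre10? G
    ... | l , q | no ¬s =
      let (f , f∈ , inc , _) = deg1⇒leaf {V} {e₀ ∷ E₀} q
          (ps , hs) = collect (All.map (λ { (fo′ , s) → M′-exists n _ fo′ (≤-trans s lt) })
            (minors-decrease fo (pendant-list fo) (pendant-∈ {G} f∈ inc q)))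
      in sumR ps , pend G ps eq (λ ()) ¬h ¬s hs
    ... | l , q | yes s@(c , mc , c∈ , star , is10) =
      let (e , largest-e@(_ , _ , _ , _ , e∈ , _)) = largest-leaf-edge fo q
          -- A centre of mark (1,0) and degree one would itself be absorbable.
          (_ , f∈) = star-second fo e∈ c∈ star (λ dc → ¬h (_ , c∈ , dc , is10))
          (ps , hs) = collect (All.map (λ { (fo′ , s) → M′-exists n _ fo′ (≤-trans s lt) })
            (minors-decrease fo (pendantList-filter (λ f → not (eqE f e)) (pendant-list fo)) f∈))
      in sumR ps , pendStar G e ps eq (λ ()) ¬h s largest-e hs

-- Every run computes the subset expansion

module _ {c ℓ : Level} (R : CommutativeRing c ℓ) (_≤M_ : Rel Mark 0ℓ) (z : ℕ → ℕ → CommutativeRing.Carrier R) where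
  open CommutativeRing R using (Carrier; _≈_; +-cong; *-cong) renaming (refl to ≈-refl; sym to ≈-sym; trans to ≈-trans; reflexive to ≈-reflexive)
  open WithRing R
  open M′ _≤M_ (Dbullet z)
  open Bullet R z using (bullet; bullet-one; bullet-rec; z₁)
  open Polynomial R bullet
  open Absorption z₁ bullet-one bullet-rec

  sumR-pointwise : ∀ {Gs ps} → Pointwise (λ H p → M H ≈ p) Gs ps → sumR (map M Gs) ≈ sumR ps
  sumR-pointwise [] = ≈-refl
  sumR-pointwise (e ∷ es) = +-cong e (sumR-pointwise es)

  prodR-pointwise : ∀ {Gs ps} → Pointwise (λ H p → M H ≈ p) Gs ps → prodR (map M Gs) ≈ prodR ps
  prodR-pointwise [] = ≈-refl
  prodR-pointwise (e ∷ es) = *-cong e (prodR-pointwise es)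

  -- Induction on the run, with the forest property carried along to every graph it visits.
  -- `M-minors` holds for any list of distinct pendant edges, so holding one back in the star case
  -- changes only the list to which it is applied.
  M′-sound : ∀ {G p} → IsMarkedForest G → IsM′ G p → M G ≈ p
  M′-sounds : ∀ {Gs ps} → All IsMarkedForest Gs → Pointwise IsM′ Gs ps → Pointwise (λ H p → M H ≈ p) Gs ps

  M′-sound fo (single (graph _ _) i m refl refl) = M-single i m
  M′-sound fo (comps G ps _ hs) = ≈-trans (M-components (forest-valid fo)) (prodR-pointwise (M′-sounds (components-forest fo) hs))
  M′-sound fo (core G G′ p _ _ co h) = let (fo′ , eq) = M-core fo co in ≈-trans eq (M′-sound fo′ h)
  M′-sound fo (pend G ps _ _ _ _ hs) =
    ≈-trans (M-minors _ refl fo (pendant-list fo)) (sumR-pointwise (M′-sounds (All.map proj₁ (minors-smaller _ refl fo (pendant-list fo))) hs))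
  M′-sound fo (pendStar G e ps _ _ _ _ _ hs) =
    ≈-trans (M-minors _ refl fo pl) (sumR-pointwise (M′-sounds (All.map proj₁ (minors-smaller _ refl fo pl)) hs))
    where
    pl = pendantList-filter (λ f → not (eqE f e)) (pendant-list fo)

  M′-sounds [] [] = []
  M′-sounds (fo ∷ fos) (h ∷ hs) = M′-sound fo h ∷ M′-sounds fos hs

theorem6p5 : ∀ {c ℓ} (R : CommutativeRing c ℓ)
    (_≤M_ : Rel Mark 0ℓ) → IsTotalOrder _≡_ _≤M_ →
    (G : MGraph) → IsMarkedForest G →
    (z : ℕ → ℕ → CommutativeRing.Carrier R) →
    Σ (CommutativeRing.Carrier R)
    (WithRing.M′.IsM′ R _≤M_ (WithRing.Dbullet R z) G) ×
    (∀ p → WithRing.M′.IsM′ R _≤M_ (WithRing.Dbullet R z) G p →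
    CommutativeRing._≈_ R (WithRing.Dpoly R z G) p)
theorem6p5 R _≤M_ tot G fo z =
  M′-exists _≤M_ tot R (WithRing.Dbullet R z) (suc (size G)) G fo ≤-refl ,
  λ p h → M′-sound R _≤M_ z fo h
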